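{- Let $\mathcal{T}\subset\binom{[n]}{3}$ be a $2$-resilient family with matching number $\nu(\mathcal{T})=2$. Then for any $u,v\in[n]$, $|\mathcal{T}_{uv}|\le 36$, where $\mathcal{T}_{uv}=\{T\in\mathcal{T}: T\cap\{u,v\}\neq\emptyset\}$.
   Context: $[n]=\{1,\dots,n\}$ and $\binom{[n]}{3}$ is the family of all $3$-element subsets of $[n]$. The matching number $\nu(\mathcal{F})$ of a family $\mathcal{F}$ is the maximum number of pairwise disjoint members of $\mathcal{F}$. For $T\subset[n]$, $\mathcal{F}(\overline{T})=\{F\in\mathcal{F}: F\cap T=\emptyset\}$. A family $\mathcal{F}$ is $t$-resilient if $\nu(\mathcal{F}(\overline{T}))=\nu(\mathcal{F})$ for every $T\subset[n]$ with $|T|\le t$. -}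

module Defs where

open import Data.Nat.Base using (ℕ; _≤_)
open import Data.Fin.Subset using (Subset; ∣_∣; _∩_; Empty)
open import Data.Fin.Subset.Properties using (nonempty?)
open import Data.List.Base using (List; []; _∷_; _++_; map; filter; length)
open import Data.List.Extrema.Nat using (max)
open import Data.List.Relation.Unary.All using (All)
open import Data.List.Relation.Unary.AllPairs using (allPairs?)
open import Data.List.Relation.Unary.Unique.Propositional using (Unique)
import Data.List.Relation.Unary.Unique.Propositional.Properties as Unique
open import Relation.Binary.Definitions using (Decidable)
open import Relation.Binary.PropositionalEquality.Core using (_≡_)
open import Relation.Nullary.Decidable using (¬?)
import Relation.Unary as U

-- The ground set [n] is Fin n.  A family of subsets of [n] is a
-- repetition-free list, so its cardinality is the length of the list.
record Family (n : ℕ) : Set where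
  constructor mkFamily
  field
    members : List (Subset n)
    unique  : Unique members

open Family public

card : ∀ {n} → Family n → ℕ
card 𝓕 = length (members 𝓕)

Uniform : ∀ {n} → ℕ → Family n → Set
Uniform k 𝓕 = All (λ F → ∣ F ∣ ≡ k) (members 𝓕)

subfamily : ∀ {n} {P : Subset n → Set} → U.Decidable P → Family n → Family n
subfamily P? 𝓕 = mkFamily (filter P? (members 𝓕)) (Unique.filter⁺ P? (unique 𝓕))

Disjoint : ∀ {n} → Subset n → Subset n → Set
Disjoint F G = Empty (F ∩ G)

disjoint? : ∀ {n} → Decidable (Disjoint {n})
disjoint? F G = ¬? (nonempty? (F ∩ G))

-- 𝓕 avoiding T is 𝓕(T̄) = { F ∈ 𝓕 : F ∩ T = ∅ }.
_avoiding_ : ∀ {n} → Family n → Subset n → Family n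
𝓕 avoiding T = subfamily (λ F → disjoint? F T) 𝓕

-- 𝓕 meeting T is { F ∈ 𝓕 : F ∩ T ≠ ∅ }.
_meeting_ : ∀ {n} → Family n → Subset n → Family n
𝓕 meeting T = subfamily (λ F → nonempty? (F ∩ T)) 𝓕

-- On a repetition-free list, these represent each subset of its set of
-- elements exactly once.
sublists : ∀ {A : Set} → List A → List (List A)
sublists []       = [] ∷ []
sublists (x ∷ xs) = map (x ∷_) (sublists xs) ++ sublists xs

matchings : ∀ {n} → Family n → List (List (Subset n))
matchings 𝓕 = filter (allPairs? disjoint?) (sublists (members 𝓕))

-- The default value 0 of max is the size of the empty matching, which
-- always exists.
ν : ∀ {n} → Family n → ℕ
ν 𝓕 = max 0 (map length (matchings 𝓕))

Resilient : ∀ {n} → ℕ → Family n → Set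
Resilient {n} t 𝓕 = (T : Subset n) → ∣ T ∣ ≤ t → ν (𝓕 avoiding T) ≡ ν 𝓕

{-# OPTIONS --safe #-}
module Submission where

-- Let u ≢ v and let A, B be disjoint edges avoiding u and v.  As ν = 2, every
-- edge meeting {u,v} is either crossing (it meets A and B), or it meets only A
-- or only B.  Let H be the number of those meeting A but not B and C the number
-- of crossing ones.  The claim 2H + C ≤ 36, added to the same claim for B, gives
-- the theorem.
--
-- Fix a corner x of A and w ∈ {u,v}, and consider the third vertices y of the
-- edges {w,x,y}.  A 2-matching {F,G} avoiding w and x contains all of them, so
-- there are at most 6.  If F or G is disjoint from B, that edge together with B
-- is again a 2-matching and contains every y outside B; otherwise F ∪ G uses up
-- a point of F ∩ B and a point of G ∩ B.  So at most 4 of the y lie outside B,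
-- and at most 3 lie outside A ∪ B, since F ∪ G also contains a point of A.
-- Finally two edges disjoint from B must intersect.  The claim follows from
-- these constraints by arithmetic.
--
-- If u = v, then v is replaced by a vertex of an edge avoiding u.

open import Defs
open import Data.Nat.Base using (ℕ; zero; suc; _+_; _*_; _≤_; z≤n; s≤s; 2+)
open import Data.Nat.Properties using (≤-refl; ≤-reflexive; ≤-trans; <⇒≱; ≰⇒>; _≤?_; m≤m+n; m≤n⇒m≤1+n;
  +-mono-≤; *-monoʳ-≤; +-identityʳ; +-suc; +-cancelˡ-≤; *-cancelˡ-≤)
open import Data.Nat.Tactic.RingSolver using (solve-∀)
open import Data.Bool.Base using (true; false)
import Data.Bool.Properties as Bool
open import Data.Empty using (⊥-elim)
open import Data.Fin.Base using (Fin; zero; suc)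
import Data.Fin.Properties as Fin
open import Data.Fin.Subset using (Subset; inside; outside; ∣_∣; _∩_; _∪_; ⁅_⁆; _∈_; _∉_)
open import Data.Fin.Subset.Properties using (nonempty?; _∈?_; x∈p∩q⁺; x∈p∩q⁻; x∈p∪q⁺; x∈p∪q⁻;
  x∈⁅x⁆; x∈⁅y⁆⇒x≡y; ⊆-antisym; ∪-comm; ∪-assoc)
open import Data.List.Base using (List; []; _∷_; _++_; map; filter; length; allFin)
open import Data.List.Extrema.Nat using (argmax-sel; xs≤max)
open import Data.List.Membership.Propositional using () renaming (_∈_ to _∈ˡ_)
import Data.List.Membership.DecPropositional as DecMembership
open import Data.List.Membership.Propositional.Properties using (∈-∃++; ∈-filter⁺; ∈-filter⁻; ∈-map⁺; ∈-map⁻;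
  ∈-++⁺ˡ; ∈-++⁺ʳ; ∈-++⁻; ∈-allFin)
open import Data.List.Properties using (length-++; length-map; map-++; filter-++; length-filter)
open import Data.List.Relation.Binary.Subset.Propositional using () renaming (_⊆_ to _⊆ˡ_)
import Data.List.Relation.Unary.All as All
open import Data.List.Relation.Unary.All using ([]; _∷_)
import Data.List.Relation.Unary.All.Properties as All
open import Data.List.Relation.Unary.AllPairs using (AllPairs; allPairs?; []; _∷_)
open import Data.List.Relation.Unary.Any using (here; there)
open import Data.List.Relation.Unary.Unique.Propositional using (Unique)
import Data.List.Relation.Unary.Unique.Propositional.Properties as Unique
import Data.Product.Base as Product
open import Data.Product.Base using (∃; ∃₂; _×_; _,_; proj₁; proj₂)
import Data.Sum.Base as Sum
open import Data.Sum.Base using (_⊎_; inj₁; inj₂; [_,_]′)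
open import Data.Vec.Base using ([]; _∷_)
import Data.Vec.Base as Vec
import Data.Vec.Properties as Vec
open import Function.Base using (_∘_; id)
open import Relation.Binary.PropositionalEquality using (_≡_; _≢_; refl; sym; trans; cong; cong₂; subst; subst₂)
open import Relation.Nullary.Decidable using (Dec; yes; no; does; ¬?; _×-dec_; True; toWitness)
open import Relation.Nullary.Negation using (¬_; contradiction)
import Relation.Unary as U

-- Arithmetic of the counts at the three corners of A

-- The counts at a corner x of A, where y and z are the other two corners: outᵤ
-- is the number of edges {u,x,o} with o outside A ∪ B ∪ {u,v}, oppᵤ that of
-- {u,y,z}, mid that of {u,v,x}, crossᵤ that of {u,x,b} with b ∈ B.
record Profile : Set where
  constructor profile
  field
    outᵤ outᵥ oppᵤ oppᵥ mid crossᵤ crossᵥ : ℕ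

open Profile

-- The share of one corner in 2H + C.
weight : Profile → ℕ
weight x = 2 * (outᵤ x + outᵥ x + oppᵤ x + oppᵥ x + mid x) + crossᵤ x + crossᵥ x

-- The constraints at a corner x for one of the ends u, v; `opp′` belongs to the other end. `clash`
-- records that {u,x,o} and {v,y,z} would be disjoint from each other and from B.
record HalfLocal (out opp opp′ mid cross : ℕ) : Set where
  constructor half
  field
    out≤3   : mid + out ≤ 3
    opp≤1   : opp ≤ 1
    cross≤3 : cross ≤ 3
    clash   : out ≡ 0 ⊎ opp′ ≡ 0

Local : Profile → Set
Local (profile α β i j s c d) = s ≤ 1 × HalfLocal α i j s c × HalfLocal β j i s d

swap : Profile → Profile
swap (profile α β i j s c d) = profile β α j i s d c

-- Edges {u,x,o} and {v,y,o'} at different corners x, y can only meet in o = o'. If both kinds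
-- exist, all the points o and o' therefore coincide.
Thin : ℕ → ℕ → Set
Thin m n = m ≡ 0 ⊎ n ≡ 0 ⊎ (m ≤ 1 × n ≤ 1)

Cross : Profile → Profile → Set
Cross x y = Thin (outᵤ x) (outᵥ y)

-- The two bounds are those on the third vertices outside B and on all third vertices.
Star : Profile → Profile → Profile → Set
Star x y z = (mid x + (oppᵤ z + (oppᵤ y + outᵤ x)) ≤ 4)
           × (crossᵤ x + (mid x + (oppᵤ z + (oppᵤ y + outᵤ x))) ≤ 6)

Stars : Profile → Profile → Profile → Set
Stars x y z = Star x y z × Star (swap x) (swap y) (swap z)

record Admissible (x y z : Profile) : Set where
  constructor admissible
  field
    lx : Local x
    ly : Local y
    lz : Local z
    xy : Cross x y
    yx : Cross y x
    xz : Cross x z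
    zx : Cross z x
    yz : Cross y z
    zy : Cross z y
    sx : Stars x y z
    sy : Stars y z x
    sz : Stars z x y

rotate : ∀ {x y z} → Admissible x y z → Admissible y z x
rotate (admissible lx ly lz xy yx xz zx yz zy sx sy sz) =
  admissible ly lz lx yz zy yx xy zx xz sy sz sx

thin-sym : ∀ {m n} → Thin m n → Thin n m
thin-sym (inj₁ p) = inj₂ (inj₁ p)
thin-sym (inj₂ (inj₁ p)) = inj₁ p
thin-sym (inj₂ (inj₂ (p , q))) = inj₂ (inj₂ (q , p))

swap-admissible : ∀ {x y z} → Admissible x y z → Admissible (swap x) (swap y) (swap z)
swap-admissible (admissible (m₁ , h₁ , k₁) (m₂ , h₂ , k₂) (m₃ , h₃ , k₃)
                             xy yx xz zx yz zy (p₁ , q₁) (p₂ , q₂) (p₃ , q₃)) =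
  admissible (m₁ , k₁ , h₁) (m₂ , k₂ , h₂) (m₃ , k₃ , h₃)
    (thin-sym yx) (thin-sym xy) (thin-sym zx) (thin-sym xz) (thin-sym zy) (thin-sym yz)
    (q₁ , p₁) (q₂ , p₂) (q₃ , p₃)

swap-weight : ∀ x → weight (swap x) ≡ weight x
swap-weight (profile α β i j s c d) = lem α β i j s c d
  where
  lem : ∀ α β i j s c d → 2 * (β + α + j + i + s) + d + c ≡ 2 * (α + β + i + j + s) + c + d
  lem = solve-∀

-- Weighted sums of the constraints, case by case

slack : ∀ {l s m o} k → l + k ≡ s → s ≤ m → {True (m ≤? o)} → l ≤ o
slack k refl s≤m {m≤o} = ≤-trans (m≤m+n _ k) (≤-trans s≤m (toWitness m≤o))

infixr 5 _⊕_
_⊕_ : ∀ {a b c d} → a ≤ b → c ≤ d → a + c ≤ b + d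
_⊕_ = +-mono-≤

-- A record, so that Agda compares bounds by their parameters instead of unfolding weight.
record Bounded (x y z : Profile) : Set where
  constructor bounded
  field
    total≤36 : weight x + (weight y + weight z) ≤ 36

open Bounded

-- The sum is 2(4 + 1 + 1 + 1 + 1 + 1) + 6 · 3 = 36: the star of u at the first corner, the single
-- edge counted by `outᵥ` there, then `outᵤ + oppᵥ` and `mid` at the other two corners, and all six
-- cross counts.
fork-one : ∀ α₁ α₂ α₃ i₂ i₃ j₂ j₃ s₁ s₂ s₃ c₁ c₂ c₃ d₁ d₂ d₃ →
  s₁ + (i₃ + (i₂ + α₁)) ≤ 4 → α₂ + j₂ ≤ 1 → α₃ + j₃ ≤ 1 → s₂ ≤ 1 → s₃ ≤ 1 →
  c₁ ≤ 3 → c₂ ≤ 3 → c₃ ≤ 3 → d₁ ≤ 3 → d₂ ≤ 3 →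
  d₃ ≤ 3 →
  Bounded (profile α₁ 1 0 0 s₁ c₁ d₁) (profile α₂ 0 i₂ j₂ s₂ c₂ d₂) (profile α₃ 0 i₃ j₃ s₃ c₃ d₃)
fork-one α₁ α₂ α₃ i₂ i₃ j₂ j₃ s₁ s₂ s₃ c₁ c₂ c₃ d₁ d₂ d₃
  m₁≤ a₂≤ a₃≤ s₂≤ s₃≤ c₁≤ c₂≤ c₃≤ d₁≤ d₂≤ d₃≤ =
  bounded (slack 0 (regroup α₁ α₂ α₃ i₂ i₃ j₂ j₃ s₁ s₂ s₃ c₁ c₂ c₃ d₁ d₂ d₃)
    (*-monoʳ-≤ 2 (m₁≤ ⊕ ≤-refl {1} ⊕ a₂≤ ⊕ a₃≤ ⊕ s₂≤ ⊕ s₃≤) ⊕ c₁≤ ⊕ c₂≤ ⊕ c₃≤ ⊕ d₁≤ ⊕ d₂≤ ⊕ d₃≤))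
  where
  regroup : ∀ α₁ α₂ α₃ i₂ i₃ j₂ j₃ s₁ s₂ s₃ c₁ c₂ c₃ d₁ d₂ d₃ →
    (2 * (α₁ + 1 + 0 + 0 + s₁) + c₁ + d₁) + ((2 * (α₂ + 0 + i₂ + j₂ + s₂) + c₂ + d₂)
      + (2 * (α₃ + 0 + i₃ + j₃ + s₃) + c₃ + d₃)) + 0
    ≡ 2 * ((s₁ + (i₃ + (i₂ + α₁))) + (1 + ((α₂ + j₂) + ((α₃ + j₃) + (s₂ + s₃))))) + (c₁ + (c₂
      + (c₃ + (d₁ + (d₂ + d₃)))))
  regroup = solve-∀

-- The stars of u and of v at the first corner, each with both of its bounds, give 4 + 6 + 4 + 6;
-- the rest gives 2(1 + 1) + 4 · 3.
fork-many : ∀ α₁ β₁ i₂ i₃ j₂ j₃ s₁ s₂ s₃ c₁ c₂ c₃ d₁ d₂ d₃ →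
  s₁ + (i₃ + (i₂ + α₁)) ≤ 4 → c₁ + (s₁ + (i₃ + (i₂ + α₁))) ≤ 6 → s₁ + (j₃ + (j₂ + β₁)) ≤ 4 →
  d₁ + (s₁ + (j₃ + (j₂ + β₁))) ≤ 6 → s₂ ≤ 1 →
  s₃ ≤ 1 → c₂ ≤ 3 → c₃ ≤ 3 → d₂ ≤ 3 → d₃ ≤ 3 →
  Bounded (profile α₁ β₁ 0 0 s₁ c₁ d₁) (profile 0 0 i₂ j₂ s₂ c₂ d₂) (profile 0 0 i₃ j₃ s₃ c₃ d₃)
fork-many α₁ β₁ i₂ i₃ j₂ j₃ s₁ s₂ s₃ c₁ c₂ c₃ d₁ d₂ d₃
  m₁≤ n₁≤ m₁′≤ n₁′≤ s₂≤ s₃≤ c₂≤ c₃≤ d₂≤ d₃≤ =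
  -- The edge counted by `s₁` lies in both stars, so the four bounds count it four times where the
  -- weight needs two.
  bounded (slack (2 * s₁) (regroup α₁ β₁ i₂ i₃ j₂ j₃ s₁ s₂ s₃ c₁ c₂ c₃ d₁ d₂ d₃)
    (m₁≤ ⊕ n₁≤ ⊕ m₁′≤ ⊕ n₁′≤ ⊕ *-monoʳ-≤ 2 (s₂≤ ⊕ s₃≤) ⊕ c₂≤ ⊕ c₃≤ ⊕ d₂≤ ⊕ d₃≤))
  where
  regroup : ∀ α₁ β₁ i₂ i₃ j₂ j₃ s₁ s₂ s₃ c₁ c₂ c₃ d₁ d₂ d₃ →
    (2 * (α₁ + β₁ + 0 + 0 + s₁) + c₁ + d₁) + ((2 * (0 + 0 + i₂ + j₂ + s₂) + c₂ + d₂)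
      + (2 * (0 + 0 + i₃ + j₃ + s₃) + c₃ + d₃)) + 2 * s₁
    ≡ (s₁ + (i₃ + (i₂ + α₁))) + ((c₁ + (s₁ + (i₃ + (i₂ + α₁)))) + ((s₁ + (j₃ + (j₂ + β₁)))
      + ((d₁ + (s₁ + (j₃ + (j₂ + β₁)))) + (2 * (s₂ + s₃) + (c₂ + (c₃ + (d₂ + d₃)))))))
  regroup = solve-∀

-- In this and the next three estimates the suffix lists the corners where `oppᵥ` vanishes; at the
-- others `outᵤ` does. The star of u is used at the listed corners. Here the sum is 4 + 6 + 2 · 5 +
-- 5 · 3 = 35.
star-at-1 : ∀ α₁ i₁ i₂ i₃ j₂ j₃ s₁ s₂ s₃ c₁ c₂ c₃ d₁ d₂ d₃ →
  s₁ + (i₃ + (i₂ + α₁)) ≤ 4 → c₁ + (s₁ + (i₃ + (i₂ + α₁))) ≤ 6 → i₁ ≤ 1 → j₂ ≤ 1 → j₃ ≤ 1 →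
  s₂ ≤ 1 → s₃ ≤ 1 → c₂ ≤ 3 → c₃ ≤ 3 → d₁ ≤ 3 →
  d₂ ≤ 3 → d₃ ≤ 3 →
  Bounded (profile α₁ 0 i₁ 0 s₁ c₁ d₁) (profile 0 0 i₂ j₂ s₂ c₂ d₂) (profile 0 0 i₃ j₃ s₃ c₃ d₃)
star-at-1 α₁ i₁ i₂ i₃ j₂ j₃ s₁ s₂ s₃ c₁ c₂ c₃ d₁ d₂ d₃
  m₁≤ n₁≤ i₁≤ j₂≤ j₃≤ s₂≤ s₃≤ c₂≤ c₃≤ d₁≤ d₂≤ d₃≤ =
  bounded (slack 0 (regroup α₁ i₁ i₂ i₃ j₂ j₃ s₁ s₂ s₃ c₁ c₂ c₃ d₁ d₂ d₃)
    (m₁≤ ⊕ n₁≤ ⊕ *-monoʳ-≤ 2 (i₁≤ ⊕ j₂≤ ⊕ j₃≤ ⊕ s₂≤ ⊕ s₃≤) ⊕ c₂≤ ⊕ c₃≤ ⊕ d₁≤ ⊕ d₂≤ ⊕ d₃≤))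
  where
  regroup : ∀ α₁ i₁ i₂ i₃ j₂ j₃ s₁ s₂ s₃ c₁ c₂ c₃ d₁ d₂ d₃ →
    (2 * (α₁ + 0 + i₁ + 0 + s₁) + c₁ + d₁) + ((2 * (0 + 0 + i₂ + j₂ + s₂) + c₂ + d₂)
      + (2 * (0 + 0 + i₃ + j₃ + s₃) + c₃ + d₃)) + 0
    ≡ (s₁ + (i₃ + (i₂ + α₁))) + ((c₁ + (s₁ + (i₃ + (i₂ + α₁)))) + (2 * (i₁ + (j₂ + (j₃
      + (s₂ + s₃)))) + (c₂ + (c₃ + (d₁ + (d₂ + d₃))))))
  regroup = solve-∀

star-at-12 : ∀ α₁ α₂ i₁ i₂ i₃ j₃ s₁ s₂ s₃ c₁ c₂ c₃ d₁ d₂ d₃ →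
  s₁ + (i₃ + (i₂ + α₁)) ≤ 4 → c₁ + (s₁ + (i₃ + (i₂ + α₁))) ≤ 6 → s₂ + (i₁ + (i₃ + α₂)) ≤ 4 →
  c₂ + (s₂ + (i₁ + (i₃ + α₂))) ≤ 6 → j₃ ≤ 1 →
  s₃ ≤ 1 → c₃ ≤ 3 → d₁ ≤ 3 → d₂ ≤ 3 → d₃ ≤ 3 →
  Bounded (profile α₁ 0 i₁ 0 s₁ c₁ d₁) (profile α₂ 0 i₂ 0 s₂ c₂ d₂) (profile 0 0 i₃ j₃ s₃ c₃ d₃)
star-at-12 α₁ α₂ i₁ i₂ i₃ j₃ s₁ s₂ s₃ c₁ c₂ c₃ d₁ d₂ d₃
  m₁≤ n₁≤ m₂≤ n₂≤ j₃≤ s₃≤ c₃≤ d₁≤ d₂≤ d₃≤ =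
  -- The edge counted by `i₃` consists of u and the first two corners, so it lies in both stars and
  -- is counted four times where the weight needs two.
  bounded (slack (2 * i₃) (regroup α₁ α₂ i₁ i₂ i₃ j₃ s₁ s₂ s₃ c₁ c₂ c₃ d₁ d₂ d₃)
    (m₁≤ ⊕ n₁≤ ⊕ m₂≤ ⊕ n₂≤ ⊕ *-monoʳ-≤ 2 (j₃≤ ⊕ s₃≤) ⊕ c₃≤ ⊕ d₁≤ ⊕ d₂≤ ⊕ d₃≤))
  where
  regroup : ∀ α₁ α₂ i₁ i₂ i₃ j₃ s₁ s₂ s₃ c₁ c₂ c₃ d₁ d₂ d₃ →
    (2 * (α₁ + 0 + i₁ + 0 + s₁) + c₁ + d₁) + ((2 * (α₂ + 0 + i₂ + 0 + s₂) + c₂ + d₂)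
      + (2 * (0 + 0 + i₃ + j₃ + s₃) + c₃ + d₃)) + 2 * i₃
    ≡ (s₁ + (i₃ + (i₂ + α₁))) + ((c₁ + (s₁ + (i₃ + (i₂ + α₁)))) + ((s₂ + (i₁ + (i₃ + α₂)))
      + ((c₂ + (s₂ + (i₁ + (i₃ + α₂)))) + (2 * (j₃ + s₃) + (c₃ + (d₁ + (d₂ + d₃)))))))
  regroup = solve-∀

star-at-13 : ∀ α₁ α₃ i₁ i₂ i₃ j₂ s₁ s₂ s₃ c₁ c₂ c₃ d₁ d₂ d₃ →
  s₁ + (i₃ + (i₂ + α₁)) ≤ 4 → c₁ + (s₁ + (i₃ + (i₂ + α₁))) ≤ 6 → s₃ + (i₂ + (i₁ + α₃)) ≤ 4 →
  c₃ + (s₃ + (i₂ + (i₁ + α₃))) ≤ 6 → j₂ ≤ 1 →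
  s₂ ≤ 1 → c₂ ≤ 3 → d₁ ≤ 3 → d₂ ≤ 3 → d₃ ≤ 3 →
  Bounded (profile α₁ 0 i₁ 0 s₁ c₁ d₁) (profile 0 0 i₂ j₂ s₂ c₂ d₂) (profile α₃ 0 i₃ 0 s₃ c₃ d₃)
star-at-13 α₁ α₃ i₁ i₂ i₃ j₂ s₁ s₂ s₃ c₁ c₂ c₃ d₁ d₂ d₃
  m₁≤ n₁≤ m₃≤ n₃≤ j₂≤ s₂≤ c₂≤ d₁≤ d₂≤ d₃≤ =
  bounded (slack (2 * i₂) (regroup α₁ α₃ i₁ i₂ i₃ j₂ s₁ s₂ s₃ c₁ c₂ c₃ d₁ d₂ d₃)
    (m₁≤ ⊕ n₁≤ ⊕ m₃≤ ⊕ n₃≤ ⊕ *-monoʳ-≤ 2 (j₂≤ ⊕ s₂≤) ⊕ c₂≤ ⊕ d₁≤ ⊕ d₂≤ ⊕ d₃≤))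
  where
  regroup : ∀ α₁ α₃ i₁ i₂ i₃ j₂ s₁ s₂ s₃ c₁ c₂ c₃ d₁ d₂ d₃ →
    (2 * (α₁ + 0 + i₁ + 0 + s₁) + c₁ + d₁) + ((2 * (0 + 0 + i₂ + j₂ + s₂) + c₂ + d₂)
      + (2 * (α₃ + 0 + i₃ + 0 + s₃) + c₃ + d₃)) + 2 * i₂
    ≡ (s₁ + (i₃ + (i₂ + α₁))) + ((c₁ + (s₁ + (i₃ + (i₂ + α₁)))) + ((s₃ + (i₂ + (i₁ + α₃)))
      + ((c₃ + (s₃ + (i₂ + (i₁ + α₃)))) + (2 * (j₂ + s₂) + (c₂ + (d₁ + (d₂ + d₃)))))))
  regroup = solve-∀

-- Both star bounds at all three corners would sum to 39. Each `oppᵤ` already occurs in two of the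
-- bounds 6, so the bound 4 can give way to `mid + outᵤ ≤ 3`, and 3 · 6 + 3 · 3 + 3 · 3 = 36.
star-at-123 : ∀ α₁ α₂ α₃ i₁ i₂ i₃ s₁ s₂ s₃ c₁ c₂ c₃ d₁ d₂ d₃ →
  c₁ + (s₁ + (i₃ + (i₂ + α₁))) ≤ 6 → c₂ + (s₂ + (i₁ + (i₃ + α₂))) ≤ 6 →
  c₃ + (s₃ + (i₂ + (i₁ + α₃))) ≤ 6 → s₁ + α₁ ≤ 3 → s₂ + α₂ ≤ 3 →
  s₃ + α₃ ≤ 3 → d₁ ≤ 3 → d₂ ≤ 3 → d₃ ≤ 3 →
  Bounded (profile α₁ 0 i₁ 0 s₁ c₁ d₁) (profile α₂ 0 i₂ 0 s₂ c₂ d₂) (profile α₃ 0 i₃ 0 s₃ c₃ d₃)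
star-at-123 α₁ α₂ α₃ i₁ i₂ i₃ s₁ s₂ s₃ c₁ c₂ c₃ d₁ d₂ d₃
  n₁≤ n₂≤ n₃≤ p₁≤ p₂≤ p₃≤ d₁≤ d₂≤ d₃≤ =
  bounded (slack 0 (regroup α₁ α₂ α₃ i₁ i₂ i₃ s₁ s₂ s₃ c₁ c₂ c₃ d₁ d₂ d₃)
    (n₁≤ ⊕ n₂≤ ⊕ n₃≤ ⊕ p₁≤ ⊕ p₂≤ ⊕ p₃≤ ⊕ d₁≤ ⊕ d₂≤ ⊕ d₃≤))
  where
  regroup : ∀ α₁ α₂ α₃ i₁ i₂ i₃ s₁ s₂ s₃ c₁ c₂ c₃ d₁ d₂ d₃ →
    (2 * (α₁ + 0 + i₁ + 0 + s₁) + c₁ + d₁) + ((2 * (α₂ + 0 + i₂ + 0 + s₂) + c₂ + d₂)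
      + (2 * (α₃ + 0 + i₃ + 0 + s₃) + c₃ + d₃)) + 0
    ≡ (c₁ + (s₁ + (i₃ + (i₂ + α₁)))) + ((c₂ + (s₂ + (i₁ + (i₃ + α₂)))) + ((c₃ + (s₃ + (i₂
      + (i₁ + α₃)))) + ((s₁ + α₁) + ((s₂ + α₂) + ((s₃ + α₃) + (d₁ + (d₂ + d₃)))))))
  regroup = solve-∀

sum≤1 : ∀ {α j} → α ≤ 1 → j ≤ 1 → α ≡ 0 ⊎ j ≡ 0 → α + j ≤ 1
sum≤1 α≤1 j≤1 (inj₁ refl) = j≤1
sum≤1 α≤1 j≤1 (inj₂ refl) = subst (_≤ 1) (sym (+-identityʳ _)) α≤1

thin⇒≤1 : ∀ {m} → Thin m 1 → m ≤ 1
thin⇒≤1 (inj₁ refl)             = z≤n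
thin⇒≤1 (inj₂ (inj₂ (m≤1 , _))) = m≤1

-- If 2 ≤ outᵤ and 2 ≤ outᵥ fail at all corners, then light bounds each weight by 12.
-- If 2 ≤ outᵤ x, then Thin forces outᵥ to vanish at y and z.
heavy : ∀ {x y z} → Admissible x y z → 2 ≤ outᵤ x → Bounded x y z
heavy (admissible (_ , half _ _ _ (inj₁ refl) , _) _ _ _ _ _ _ _ _ _ _ _) ()
heavy (admissible _ _ _ (inj₁ refl) _ _ _ _ _ _ _ _) ()
heavy (admissible _ _ _ (inj₂ (inj₂ (α₁≤1 , _))) _ _ _ _ _ _ _ _) 2≤α₁ = contradiction α₁≤1 (<⇒≱ 2≤α₁)
heavy (admissible _ _ _ _ _ (inj₁ refl) _ _ _ _ _ _) ()
heavy (admissible _ _ _ _ _ (inj₂ (inj₂ (α₁≤1 , _))) _ _ _ _ _ _) 2≤α₁ = contradiction α₁≤1 (<⇒≱ 2≤α₁)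
-- If `outᵥ x` is 0, then `clash` at y and at z offers `outᵤ` = 0 or `oppᵥ` = 0 at each, which makes
-- four cases.
heavy {profile α₁ zero i₁ _ s₁ c₁ d₁} {profile _ _ i₂ j₂ s₂ c₂ d₂} {profile _ _ i₃ j₃ s₃ c₃ d₃}
  (admissible (_ , half p₁≤ i₁≤ c₁≤ (inj₂ refl) , half _ _ d₁≤ _)
          (s₂≤ , half p₂≤ i₂≤ c₂≤ (inj₁ refl) , half _ j₂≤ d₂≤ _)
          (s₃≤ , half p₃≤ i₃≤ c₃≤ (inj₁ refl) , half _ j₃≤ d₃≤ _)
          (inj₂ (inj₁ refl)) _ (inj₂ (inj₁ refl)) _ _ _
          ((m₁≤ , n₁≤) , (m₁′≤ , n₁′≤)) ((m₂≤ , n₂≤) , _) ((m₃≤ , n₃≤) , _)) _ =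
  star-at-1 α₁ i₁ i₂ i₃ j₂ j₃ s₁ s₂ s₃ c₁ c₂ c₃ d₁ d₂ d₃
    m₁≤ n₁≤ i₁≤ j₂≤ j₃≤ s₂≤ s₃≤ c₂≤ c₃≤ d₁≤ d₂≤ d₃≤
heavy {profile α₁ zero i₁ _ s₁ c₁ d₁} {profile α₂ _ i₂ _ s₂ c₂ d₂} {profile _ _ i₃ j₃ s₃ c₃ d₃}
  (admissible (_ , half p₁≤ i₁≤ c₁≤ (inj₂ refl) , half _ _ d₁≤ _)
          (s₂≤ , half p₂≤ i₂≤ c₂≤ (inj₂ refl) , half _ j₂≤ d₂≤ _)
          (s₃≤ , half p₃≤ i₃≤ c₃≤ (inj₁ refl) , half _ j₃≤ d₃≤ _)
          (inj₂ (inj₁ refl)) _ (inj₂ (inj₁ refl)) _ _ _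
          ((m₁≤ , n₁≤) , (m₁′≤ , n₁′≤)) ((m₂≤ , n₂≤) , _) ((m₃≤ , n₃≤) , _)) _ =
  star-at-12 α₁ α₂ i₁ i₂ i₃ j₃ s₁ s₂ s₃ c₁ c₂ c₃ d₁ d₂ d₃
    m₁≤ n₁≤ m₂≤ n₂≤ j₃≤ s₃≤ c₃≤ d₁≤ d₂≤ d₃≤
heavy {profile α₁ zero i₁ _ s₁ c₁ d₁} {profile _ _ i₂ j₂ s₂ c₂ d₂} {profile α₃ _ i₃ _ s₃ c₃ d₃}
  (admissible (_ , half p₁≤ i₁≤ c₁≤ (inj₂ refl) , half _ _ d₁≤ _)
          (s₂≤ , half p₂≤ i₂≤ c₂≤ (inj₁ refl) , half _ j₂≤ d₂≤ _)
          (s₃≤ , half p₃≤ i₃≤ c₃≤ (inj₂ refl) , half _ j₃≤ d₃≤ _)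
          (inj₂ (inj₁ refl)) _ (inj₂ (inj₁ refl)) _ _ _
          ((m₁≤ , n₁≤) , (m₁′≤ , n₁′≤)) ((m₂≤ , n₂≤) , _) ((m₃≤ , n₃≤) , _)) _ =
  star-at-13 α₁ α₃ i₁ i₂ i₃ j₂ s₁ s₂ s₃ c₁ c₂ c₃ d₁ d₂ d₃
    m₁≤ n₁≤ m₃≤ n₃≤ j₂≤ s₂≤ c₂≤ d₁≤ d₂≤ d₃≤
heavy {profile α₁ zero i₁ _ s₁ c₁ d₁} {profile α₂ _ i₂ _ s₂ c₂ d₂} {profile α₃ _ i₃ _ s₃ c₃ d₃}
  (admissible (_ , half p₁≤ i₁≤ c₁≤ (inj₂ refl) , half _ _ d₁≤ _)
          (s₂≤ , half p₂≤ i₂≤ c₂≤ (inj₂ refl) , half _ j₂≤ d₂≤ _)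
          (s₃≤ , half p₃≤ i₃≤ c₃≤ (inj₂ refl) , half _ j₃≤ d₃≤ _)
          (inj₂ (inj₁ refl)) _ (inj₂ (inj₁ refl)) _ _ _
          ((m₁≤ , n₁≤) , (m₁′≤ , n₁′≤)) ((m₂≤ , n₂≤) , _) ((m₃≤ , n₃≤) , _)) _ =
  star-at-123 α₁ α₂ α₃ i₁ i₂ i₃ s₁ s₂ s₃ c₁ c₂ c₃ d₁ d₂ d₃
    n₁≤ n₂≤ n₃≤ p₁≤ p₂≤ p₃≤ d₁≤ d₂≤ d₃≤
-- If `outᵥ x` is 1, both `opp` counts at x vanish by `clash`, and `Thin` leaves `outᵤ` at most 1 at
-- y and z.
heavy {profile α₁ (suc zero) _ _ s₁ c₁ d₁} {profile α₂ _ i₂ j₂ s₂ c₂ d₂} {profile α₃ _ i₃ j₃ s₃ c₃ d₃}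
  (admissible (_ , half p₁≤ i₁≤ c₁≤ (inj₂ refl) , half _ _ d₁≤ (inj₂ refl))
          (s₂≤ , half p₂≤ i₂≤ c₂≤ f₂ , half _ j₂≤ d₂≤ _)
          (s₃≤ , half p₃≤ i₃≤ c₃≤ f₃ , half _ j₃≤ d₃≤ _)
          (inj₂ (inj₁ refl)) yx (inj₂ (inj₁ refl)) zx _ _
          ((m₁≤ , n₁≤) , (m₁′≤ , n₁′≤)) ((m₂≤ , n₂≤) , _) ((m₃≤ , n₃≤) , _)) _ =
  fork-one α₁ α₂ α₃ i₂ i₃ j₂ j₃ s₁ s₂ s₃ c₁ c₂ c₃ d₁ d₂ d₃
    m₁≤ (sum≤1 (thin⇒≤1 yx) j₂≤ f₂) (sum≤1 (thin⇒≤1 zx) j₃≤ f₃) s₂≤ s₃≤ c₁≤ c₂≤ c₃≤ d₁≤ d₂≤ d₃≤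
-- If `outᵥ x` is at least 2, `Thin` also forces `outᵤ` to vanish at y and z.
heavy {profile α₁ (2+ b) _ _ s₁ c₁ d₁} {profile _ _ i₂ j₂ s₂ c₂ d₂} {profile _ _ i₃ j₃ s₃ c₃ d₃}
  (admissible (_ , half p₁≤ i₁≤ c₁≤ (inj₂ refl) , half _ _ d₁≤ (inj₂ refl))
          (s₂≤ , half p₂≤ i₂≤ c₂≤ _ , half _ j₂≤ d₂≤ _)
          (s₃≤ , half p₃≤ i₃≤ c₃≤ _ , half _ j₃≤ d₃≤ _)
          (inj₂ (inj₁ refl)) (inj₁ refl) (inj₂ (inj₁ refl)) (inj₁ refl) _ _
          ((m₁≤ , n₁≤) , (m₁′≤ , n₁′≤)) ((m₂≤ , n₂≤) , _) ((m₃≤ , n₃≤) , _)) _ =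
  fork-many α₁ (2+ b) i₂ i₃ j₂ j₃ s₁ s₂ s₃ c₁ c₂ c₃ d₁ d₂ d₃
    m₁≤ n₁≤ m₁′≤ n₁′≤ s₂≤ s₃≤ c₂≤ c₃≤ d₂≤ d₃≤
heavy {profile _ (2+ _) _ _ _ _ _} (admissible _ _ _ _ (inj₂ (inj₂ (_ , s≤s ()))) _ _ _ _ _ _ _) _
heavy {profile _ (2+ _) _ _ _ _ _} (admissible _ _ _ _ _ _ (inj₂ (inj₂ (_ , s≤s ()))) _ _ _ _ _) _

-- `clash` pairs `outᵤ` with `oppᵥ` and `outᵥ` with `oppᵤ`. Each pair now sums to at most 1, so the
-- weight is at most 2(1 + 1 + 1) + 3 + 3.
light : ∀ x → Local x → outᵤ x ≤ 1 → outᵥ x ≤ 1 → weight x ≤ 12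
light (profile α β i j s c d) (s≤1 , half _ i≤1 c≤3 f , half _ j≤1 d≤3 e) α≤1 β≤1 =
  slack 0 (lem α β i j s c d) (*-monoʳ-≤ 2 (sum≤1 α≤1 j≤1 f ⊕ sum≤1 β≤1 i≤1 e ⊕ s≤1) ⊕ c≤3 ⊕ d≤3)
  where
  lem : ∀ α β i j s c d → 2 * (α + β + i + j + s) + c + d + 0 ≡ 2 * ((α + j) + ((β + i) + s)) + (c + d)
  lem = solve-∀

light-or-total : ∀ {x y z} → Admissible x y z → weight x ≤ 12 ⊎ weight x + (weight y + weight z) ≤ 36
light-or-total {x} {y} {z} t with outᵤ x ≤? 1 | outᵥ x ≤? 1
... | yes p | yes q = inj₁ (light x (Admissible.lx t) p q)
... | no p  | _     = inj₂ (total≤36 (heavy t (≰⇒> p)))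
... | yes _ | no q  = inj₂ (subst (_≤ 36)
  (cong₂ _+_ (swap-weight x) (cong₂ _+_ (swap-weight y) (swap-weight z)))
  (total≤36 (heavy (swap-admissible t) (≰⇒> q))))

weight≤36 : ∀ {x y z} → Admissible x y z → weight x + (weight y + weight z) ≤ 36
weight≤36 {x} {y} {z} t with light-or-total t | light-or-total (rotate t) | light-or-total (rotate (rotate t))
... | inj₂ p | _      | _      = p
... | inj₁ _ | inj₂ p | _      = subst (_≤ 36) (rot (weight x) (weight y) (weight z)) p
  where
  rot : ∀ a b c → b + (c + a) ≡ a + (b + c)
  rot = solve-∀
... | inj₁ _ | inj₁ _ | inj₂ p = subst (_≤ 36) (rot (weight x) (weight y) (weight z)) p
  where
  rot : ∀ a b c → c + (a + b) ≡ a + (b + c)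
  rot = solve-∀
... | inj₁ p | inj₁ q | inj₁ r = p ⊕ q ⊕ r

-- Adding the two counts gives 2N ≤ (2a + c) + (2b + d) ≤ 72. The crossing edges get listed once
-- from each side, and each of the two lists serves one of the counts.
average-bound : ∀ a b c d {N} → N ≤ a + (b + c) → N ≤ a + (b + d) → 2 * a + c ≤ 36 → 2 * b + d ≤ 36 → N ≤ 36
average-bound a b c d {N} N≤₁ N≤₂ ac≤ bd≤ =
  *-cancelˡ-≤ {N} {36} 2 (subst₂ _≤_ (double N) refl
    (≤-trans (N≤₁ ⊕ N≤₂) (≤-trans (≤-reflexive (regroup a b c d)) (ac≤ ⊕ bd≤))))
  where
  double : ∀ m → m + m ≡ 2 * m
  double = solve-∀
  regroup : ∀ a b c d → (a + (b + c)) + (a + (b + d)) ≡ (2 * a + c) + (2 * b + d)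
  regroup = solve-∀

-- Subsets and lists

module _ {A : Set} where

  unique-length-≤ : {xs ys : List A} → Unique xs → xs ⊆ˡ ys → length xs ≤ length ys
  unique-length-≤ [] _ = z≤n
  unique-length-≤ {x ∷ xs} (x∉xs ∷ !xs) xs⊆ys with ∈-∃++ (xs⊆ys (here refl))
  ... | ys , zs , refl = subst (suc (length xs) ≤_) (sym eq) (s≤s (unique-length-≤ !xs xs⊆))
    where
    eq : length (ys ++ x ∷ zs) ≡ suc (length (ys ++ zs))
    eq = trans (length-++ ys) (trans (+-suc (length ys) (length zs)) (cong suc (sym (length-++ ys))))
    xs⊆ : xs ⊆ˡ ys ++ zs
    xs⊆ z∈xs with ∈-++⁻ ys (xs⊆ys (there z∈xs))
    ... | inj₁ z∈ys         = ∈-++⁺ˡ z∈ys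
    ... | inj₂ (here refl)  = contradiction refl (All.lookup x∉xs z∈xs)
    ... | inj₂ (there z∈zs) = ∈-++⁺ʳ ys z∈zs

  -- `sublists` keeps the order of the list, so a matching has to be presented as a filter of
  -- `members` to be found among the `matchings`.
  filter∈sublists : {P : A → Set} (P? : U.Decidable P) (xs : List A) → filter P? xs ∈ˡ sublists xs
  filter∈sublists P? []       = here refl
  filter∈sublists P? (x ∷ xs) with does (P? x)
  ... | true  = ∈-++⁺ˡ (∈-map⁺ (x ∷_) (filter∈sublists P? xs))
  ... | false = ∈-++⁺ʳ (map (x ∷_) (sublists xs)) (filter∈sublists P? xs)

  sublists-⊆ : ∀ {xs ys : List A} → ys ∈ˡ sublists xs → ys ⊆ˡ xs
  sublists-⊆ {[]}     (here refl) z∈ys = z∈ys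
  sublists-⊆ {x ∷ xs} ys∈ z∈ys with ∈-++⁻ (map (x ∷_) (sublists xs)) ys∈
  ... | inj₂ ys∈′ = there (sublists-⊆ ys∈′ z∈ys)
  ... | inj₁ ys∈′ with ∈-map⁻ (x ∷_) ys∈′
  ...   | zs , zs∈ , refl with z∈ys
  ...     | here z≡x    = here z≡x
  ...     | there z∈zs = there (sublists-⊆ zs∈ z∈zs)

  unique⇒allPairs : {R : A → A → Set} {xs : List A} → Unique xs →
    (∀ {x y} → x ∈ˡ xs → y ∈ˡ xs → x ≢ y → R x y) → AllPairs R xs
  unique⇒allPairs []           r = []
  unique⇒allPairs (x∉xs ∷ !xs) r =
    All.tabulate (λ y∈ → r (here refl) (there y∈) (All.lookup x∉xs y∈))
    ∷ unique⇒allPairs !xs (λ x∈ y∈ → r (there x∈) (there y∈))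

  length-filter-map : {B : Set} {P : B → Set} (P? : U.Decidable P) (f : A → B) (xs : List A) →
    length (filter P? (map f xs)) ≡ length (filter (P? ∘ f) xs)
  length-filter-map P? f []       = refl
  length-filter-map P? f (x ∷ xs) with does (P? (f x))
  ... | true  = cong suc (length-filter-map P? f xs)
  ... | false = length-filter-map P? f xs

elements : ∀ {n} → Subset n → List (Fin n)
elements []            = []
elements (outside ∷ p) = map suc (elements p)
elements (inside ∷ p)  = zero ∷ map suc (elements p)

length-elements : ∀ {n} (p : Subset n) → length (elements p) ≡ ∣ p ∣
length-elements []            = refl
length-elements (outside ∷ p) = trans (length-map suc (elements p)) (length-elements p)
length-elements (inside ∷ p)  = cong suc (trans (length-map suc (elements p)) (length-elements p))

∈-elements⁺ : ∀ {n} {p : Subset n} {x} → x ∈ p → x ∈ˡ elements p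
∈-elements⁺ {p = inside ∷ p}  Vec.here        = here refl
∈-elements⁺ {p = inside ∷ p}  (Vec.there x∈p) = there (∈-map⁺ suc (∈-elements⁺ x∈p))
∈-elements⁺ {p = outside ∷ p} (Vec.there x∈p) = ∈-map⁺ suc (∈-elements⁺ x∈p)

∈-elements⁻ : ∀ {n} (p : Subset n) {x} → x ∈ˡ elements p → x ∈ p
∈-elements⁻ (inside ∷ p)  (here refl) = Vec.here
∈-elements⁻ (inside ∷ p)  (there x∈) with ∈-map⁻ suc x∈
... | y , y∈ , refl = Vec.there (∈-elements⁻ p y∈)
∈-elements⁻ (outside ∷ p) x∈ with ∈-map⁻ suc x∈
... | y , y∈ , refl = Vec.there (∈-elements⁻ p y∈)

elements-unique : ∀ {n} (p : Subset n) → Unique (elements p)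
elements-unique []            = []
elements-unique (outside ∷ p) = Unique.map⁺ Fin.suc-injective (elements-unique p)
elements-unique (inside ∷ p)  =
  All.map⁺ (All.universal (λ _ ()) (elements p)) ∷ Unique.map⁺ Fin.suc-injective (elements-unique p)

record Corners {n} (E : Subset n) : Set where
  constructor corners
  field
    {a b c} : Fin n
    a∈  : a ∈ E
    b∈  : b ∈ E
    c∈  : c ∈ E
    a≢b : a ≢ b
    b≢c : b ≢ c
    c≢a : c ≢ a
    cover : ∀ {z} → z ∈ E → z ∈ˡ a ∷ b ∷ c ∷ []

corners-of : ∀ {n} (E : Subset n) → ∣ E ∣ ≡ 3 → Corners E
corners-of E eq = go (elements E) (trans (length-elements E) eq) (elements-unique E) ∈-elements⁺ (∈-elements⁻ E)
  where
  go : ∀ zs → length zs ≡ 3 → Unique zs → (∀ {z} → z ∈ E → z ∈ˡ zs) → (∀ {z} → z ∈ˡ zs → z ∈ E) → Corners E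
  go (a ∷ b ∷ c ∷ []) _ ((a≢b ∷ a≢c ∷ []) ∷ (b≢c ∷ []) ∷ _) cov mem =
    corners (mem (here refl)) (mem (there (here refl))) (mem (there (there (here refl)))) a≢b b≢c (a≢c ∘ sym) cov

∣∣-≤ : ∀ {n} (p : Subset n) zs → (∀ {x} → x ∈ p → x ∈ˡ zs) → ∣ p ∣ ≤ length zs
∣∣-≤ p zs p⊆zs = subst (_≤ length zs) (length-elements p)
  (unique-length-≤ (elements-unique p) (p⊆zs ∘ ∈-elements⁻ p))

disjoint⁺ : ∀ {n} {F G : Subset n} → (∀ {x} → x ∈ F → x ∉ G) → Disjoint F G
disjoint⁺ {F = F} {G} f (x , x∈) = let (x∈F , x∈G) = x∈p∩q⁻ F G x∈ in f x∈F x∈G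

disjoint⁻ : ∀ {n} {F G : Subset n} → Disjoint F G → ∀ {x} → x ∈ F → x ∉ G
disjoint⁻ F#G x∈F x∈G = F#G (_ , x∈p∩q⁺ (x∈F , x∈G))

disjoint-sym : ∀ {n} {F G : Subset n} → Disjoint F G → Disjoint G F
disjoint-sym {F = F} {G} F#G = disjoint⁺ λ x∈G x∈F → disjoint⁻ {F = F} {G} F#G x∈F x∈G

disjoint-or-common : ∀ {n} (F G : Subset n) → Disjoint F G ⊎ ∃ λ x → x ∈ F × x ∈ G
disjoint-or-common F G with nonempty? (F ∩ G)
... | yes (x , x∈) = inj₂ (x , x∈p∩q⁻ F G x∈)
... | no F#G       = inj₁ F#G

_≟ˢ_ : ∀ {n} (F G : Subset n) → Dec (F ≡ G)
_≟ˢ_ = Vec.≡-dec Bool._≟_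

triple : ∀ {n} → Fin n → Fin n → Fin n → Subset n
triple x y z = ⁅ x ⁆ ∪ (⁅ y ⁆ ∪ ⁅ z ⁆)

triple-swapʳ : ∀ {n} (x y z : Fin n) → triple x y z ≡ triple x z y
triple-swapʳ x y z = cong (⁅ x ⁆ ∪_) (∪-comm ⁅ y ⁆ ⁅ z ⁆)

triple-swapˡ : ∀ {n} (x y z : Fin n) → triple x y z ≡ triple y x z
triple-swapˡ x y z = trans (sym (∪-assoc ⁅ x ⁆ ⁅ y ⁆ ⁅ z ⁆))
  (trans (cong (_∪ ⁅ z ⁆) (∪-comm ⁅ x ⁆ ⁅ y ⁆)) (∪-assoc ⁅ y ⁆ ⁅ x ⁆ ⁅ z ⁆))

triple-reverse : ∀ {n} (x y z : Fin n) → triple x y z ≡ triple z y x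
triple-reverse x y z = trans (triple-swapˡ x y z) (trans (triple-swapʳ y x z) (triple-swapˡ y z x))

∈-triple⁻ : ∀ {n} {x y z t : Fin n} → t ∈ triple x y z → t ≡ x ⊎ t ≡ y ⊎ t ≡ z
∈-triple⁻ {x = x} {y} {z} t∈ with x∈p∪q⁻ ⁅ x ⁆ (⁅ y ⁆ ∪ ⁅ z ⁆) t∈
... | inj₁ t∈x = inj₁ (x∈⁅y⁆⇒x≡y x t∈x)
... | inj₂ t∈yz with x∈p∪q⁻ ⁅ y ⁆ ⁅ z ⁆ t∈yz
...   | inj₁ t∈y = inj₂ (inj₁ (x∈⁅y⁆⇒x≡y y t∈y))
...   | inj₂ t∈z = inj₂ (inj₂ (x∈⁅y⁆⇒x≡y z t∈z))

∈-triple⁺ : ∀ {n} {x y z t : Fin n} → t ≡ x ⊎ t ≡ y ⊎ t ≡ z → t ∈ triple x y z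
∈-triple⁺ (inj₁ refl)        = x∈p∪q⁺ (inj₁ (x∈⁅x⁆ _))
∈-triple⁺ (inj₂ (inj₁ refl)) = x∈p∪q⁺ (inj₂ (x∈p∪q⁺ (inj₁ (x∈⁅x⁆ _))))
∈-triple⁺ (inj₂ (inj₂ refl)) = x∈p∪q⁺ (inj₂ (x∈p∪q⁺ (inj₂ (x∈⁅x⁆ _))))

third-vertex : ∀ {n} {F : Subset n} {w x} → ∣ F ∣ ≡ 3 → w ∈ F → x ∈ F → w ≢ x →
  ∃ λ y → y ∈ F × y ≢ w × y ≢ x × F ≡ triple w x y
third-vertex {F = F} {w} {x} eq w∈ x∈ w≢x
  with Fin.any? (λ y → (y ∈? F) ×-dec (¬? (y Fin.≟ w) ×-dec ¬? (y Fin.≟ x)))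
... | no ∄y = contradiction (subst (_≤ 2) eq (∣∣-≤ F (w ∷ x ∷ []) only)) λ { (s≤s (s≤s ())) }
  where
  only : ∀ {z} → z ∈ F → z ∈ˡ w ∷ x ∷ []
  only {z} z∈ with z Fin.≟ w | z Fin.≟ x
  ... | yes refl | _        = here refl
  ... | no _     | yes refl = there (here refl)
  ... | no z≢w   | no z≢x   = contradiction (z , z∈ , z≢w , z≢x) ∄y
... | yes (y , y∈ , y≢w , y≢x) = y , y∈ , y≢w , y≢x , ⊆-antisym F⊆ (⊆F ∘ ∈-triple⁻)
  where
  ⊆F : ∀ {z} → z ≡ w ⊎ z ≡ x ⊎ z ≡ y → z ∈ F
  ⊆F (inj₁ refl)        = w∈
  ⊆F (inj₂ (inj₁ refl)) = x∈
  ⊆F (inj₂ (inj₂ refl)) = y∈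

  F⊆ : ∀ {z} → z ∈ F → z ∈ triple w x y
  F⊆ {z} z∈ with z Fin.≟ w | z Fin.≟ x | z Fin.≟ y
  ... | yes e | _     | _     = ∈-triple⁺ (inj₁ e)
  ... | no _  | yes e | _     = ∈-triple⁺ (inj₂ (inj₁ e))
  ... | no _  | no _  | yes e = ∈-triple⁺ (inj₂ (inj₂ e))
  ... | no z≢w | no z≢x | no z≢y = contradiction
    (subst (4 ≤_) (trans (length-elements F) eq)
      (unique-length-≤ {xs = z ∷ w ∷ x ∷ y ∷ []}
        ((z≢w ∷ z≢x ∷ z≢y ∷ []) ∷ (w≢x ∷ (y≢w ∘ sym) ∷ []) ∷ ((y≢x ∘ sym) ∷ []) ∷ [] ∷ [])
        λ { (here refl) → ∈-elements⁺ z∈ ; (there (here refl)) → ∈-elements⁺ w∈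
          ; (there (there (here refl))) → ∈-elements⁺ x∈
          ; (there (there (there (here refl)))) → ∈-elements⁺ y∈ }))
    λ { (s≤s (s≤s (s≤s ()))) }

-- Matchings and the matching number

matching-≤ν : ∀ {n} (𝓕 : Family n) {P : Subset n → Set} (P? : U.Decidable P) →
  AllPairs Disjoint (filter P? (members 𝓕)) → length (filter P? (members 𝓕)) ≤ ν 𝓕
matching-≤ν 𝓕 P? disj = All.lookup (xs≤max 0 (map length (matchings 𝓕)))
  (∈-map⁺ length (∈-filter⁺ (allPairs? disjoint?) (filter∈sublists P? (members 𝓕)) disj))

disjoint-pair : ∀ {n} (𝓕 : Family n) → ν 𝓕 ≡ 2 →
  ∃₂ λ A B → A ∈ˡ members 𝓕 × B ∈ˡ members 𝓕 × Disjoint A B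
-- The maximum is either the default 0, which differs from 2, or the length of a listed matching.
disjoint-pair 𝓕 ν≡2 with argmax-sel id 0 (map length (matchings 𝓕))
... | inj₁ ν≡0 = contradiction (trans (sym ν≡2) ν≡0) λ ()
... | inj₂ ν∈  with ∈-map⁻ length ν∈
...   | M , M∈ , ν≡∣M∣ = go M (trans (sym ν≡∣M∣) ν≡2) M∈
  where
  go : ∀ M → length M ≡ 2 → M ∈ˡ matchings 𝓕 → ∃₂ λ A B → A ∈ˡ members 𝓕 × B ∈ˡ members 𝓕 × Disjoint A B
  go (A ∷ B ∷ []) _ M∈ with ∈-filter⁻ (allPairs? disjoint?) {xs = sublists (members 𝓕)} M∈
  ... | M∈′ , ((A#B ∷ []) ∷ _) = A , B , sublists-⊆ M∈′ (here refl) , sublists-⊆ M∈′ (there (here refl)) , A#B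

-- Families with matching number 2 resilient to the removal of two vertices

module _ {n} (𝓣 : Family n) (uniform : Uniform 3 𝓣) (resilient : Resilient 2 𝓣) (ν≡2 : ν 𝓣 ≡ 2) where

  private
    open DecMembership (_≟ˢ_ {n}) using () renaming (_∈?_ to _∈ˢ?_)

    T : Subset n → Set
    T F = F ∈ˡ members 𝓣

    T? : U.Decidable T
    T? F = F ∈ˢ? members 𝓣

    size : ∀ {F} → T F → ∣ F ∣ ≡ 3
    size = All.lookup uniform

  -- Only the empty set is disjoint from itself, and an edge has a corner.
  disjoint⇒≢ : ∀ {F G} → T F → Disjoint F G → F ≢ G
  disjoint⇒≢ {F} F∈ F#F refl = disjoint⁻ F#F a∈ a∈
    where open Corners (corners-of F (size F∈))

  no-three-disjoint : ∀ {F G H} → T F → T G → T H → Disjoint F G → Disjoint F H → ¬ Disjoint G H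
  no-three-disjoint {F} {G} {H} F∈ G∈ H∈ F#G F#H G#H =
    contradiction
      (≤-trans 3≤ (subst (length matching ≤_) ν≡2 (matching-≤ν 𝓣 P? (unique⇒allPairs !matching disj))))
      λ { (s≤s (s≤s ())) }
    where
    three = F ∷ G ∷ H ∷ []
    P? = λ E → E ∈ˢ? three
    matching = filter P? (members 𝓣)

    !matching : Unique matching
    !matching = Unique.filter⁺ P? (unique 𝓣)

    3≤ : 3 ≤ length matching
    3≤ = unique-length-≤
      ((disjoint⇒≢ F∈ F#G ∷ disjoint⇒≢ F∈ F#H ∷ []) ∷ (disjoint⇒≢ G∈ G#H ∷ []) ∷ [] ∷ [])
      λ { (here refl) → ∈-filter⁺ P? F∈ (here refl)
        ; (there (here refl)) → ∈-filter⁺ P? G∈ (there (here refl))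
        ; (there (there (here refl))) → ∈-filter⁺ P? H∈ (there (there (here refl))) }

    among : ∀ {X Y} → X ∈ˡ three → Y ∈ˡ three → X ≢ Y → Disjoint X Y
    among (here refl)                 (here refl)                 X≢X = contradiction refl X≢X
    among (here refl)                 (there (here refl))         _   = F#G
    among (here refl)                 (there (there (here refl))) _   = F#H
    among (there (here refl))         (here refl)                 _   = disjoint-sym {F = F} F#G
    among (there (here refl))         (there (here refl))         X≢X = contradiction refl X≢X
    among (there (here refl))         (there (there (here refl))) _   = G#H
    among (there (there (here refl))) (here refl)                 _   = disjoint-sym {F = F} F#H
    among (there (there (here refl))) (there (here refl))         _   = disjoint-sym {F = G} G#H
    among (there (there (here refl))) (there (there (here refl))) X≢X = contradiction refl X≢X

    disj : ∀ {X Y} → X ∈ˡ matching → Y ∈ˡ matching → X ≢ Y → Disjoint X Y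
    disj X∈ Y∈ = among (proj₂ (∈-filter⁻ P? {xs = members 𝓣} X∈)) (proj₂ (∈-filter⁻ P? {xs = members 𝓣} Y∈))

  -- An edge missing both would be a third pairwise disjoint one.
  meets-matching : ∀ {A B F} → T A → T B → Disjoint A B → T F → ∃ λ z → z ∈ F × (z ∈ A ⊎ z ∈ B)
  meets-matching {A} {B} {F} A∈ B∈ A#B F∈ with disjoint-or-common F A | disjoint-or-common F B
  ... | inj₂ (z , z∈F , z∈A) | _                    = z , z∈F , inj₁ z∈A
  ... | inj₁ _               | inj₂ (z , z∈F , z∈B) = z , z∈F , inj₂ z∈B
  ... | inj₁ F#A             | inj₁ F#B             = ⊥-elim (no-three-disjoint F∈ A∈ B∈ F#A F#B A#B)

  record MatchingAvoiding (w x : Fin n) : Set where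
    field
      {A B} : Subset n
      A∈  : T A
      B∈  : T B
      A#B : Disjoint A B
      w∉A : w ∉ A
      w∉B : w ∉ B
      x∉A : x ∉ A
      x∉B : x ∉ B

  -- This is where resilience enters: deleting {w,x} leaves the matching number equal to 2.
  matching-avoiding : ∀ w x → MatchingAvoiding w x
  matching-avoiding w x
    with disjoint-pair (𝓣 avoiding (⁅ w ⁆ ∪ ⁅ x ⁆)) (trans (resilient (⁅ w ⁆ ∪ ⁅ x ⁆) small) ν≡2)
    where
    -- Only an upper bound is claimed, so `w` and `x` may coincide.
    small : ∣ ⁅ w ⁆ ∪ ⁅ x ⁆ ∣ ≤ 2
    small = ∣∣-≤ (⁅ w ⁆ ∪ ⁅ x ⁆) (w ∷ x ∷ [])
      λ t∈ → [ (λ t∈w → here (x∈⁅y⁆⇒x≡y w t∈w)) , (λ t∈x → there (here (x∈⁅y⁆⇒x≡y x t∈x))) ]′ (x∈p∪q⁻ ⁅ w ⁆ ⁅ x ⁆ t∈)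
  ... | A , B , A∈ , B∈ , A#B
    with ∈-filter⁻ (λ F → disjoint? F (⁅ w ⁆ ∪ ⁅ x ⁆)) {xs = members 𝓣} A∈
       | ∈-filter⁻ (λ F → disjoint? F (⁅ w ⁆ ∪ ⁅ x ⁆)) {xs = members 𝓣} B∈
  ... | A∈T , A#wx | B∈T , B#wx = record
    { A∈ = A∈T ; B∈ = B∈T ; A#B = A#B
    ; w∉A = λ w∈ → disjoint⁻ {F = A} A#wx w∈ (x∈p∪q⁺ (inj₁ (x∈⁅x⁆ w)))
    ; w∉B = λ w∈ → disjoint⁻ {F = B} B#wx w∈ (x∈p∪q⁺ (inj₁ (x∈⁅x⁆ w)))
    ; x∉A = λ x∈ → disjoint⁻ {F = A} A#wx x∈ (x∈p∪q⁺ (inj₂ (x∈⁅x⁆ x)))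
    ; x∉B = λ x∈ → disjoint⁻ {F = B} B#wx x∈ (x∈p∪q⁺ (inj₂ (x∈⁅x⁆ x)))
    }

  -- Third vertices of the edges through two given vertices

  edges : Fin n → Fin n → List (Fin n) → List (Subset n)
  edges w x ys = filter T? (map (triple w x) ys)

  -- Counting along a list of candidate third vertices makes the count additive when the candidates
  -- are split into groups.
  degree : Fin n → Fin n → List (Fin n) → ℕ
  degree w x ys = length (edges w x ys)

  ∈-edges⁺ : ∀ {F w x y ys} → T F → F ≡ triple w x y → y ∈ˡ ys → F ∈ˡ edges w x ys
  ∈-edges⁺ {w = w} {x} F∈ refl y∈ = ∈-filter⁺ T? (∈-map⁺ (triple w x) y∈) F∈

  degree-∷ : ∀ w x y ys → degree w x (y ∷ ys) ≡ degree w x (y ∷ []) + degree w x ys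
  degree-∷ w x y ys = trans
    (cong length (filter-++ T? (triple w x y ∷ []) (map (triple w x) ys)))
    (length-++ (edges w x (y ∷ [])))

  degree-++ : ∀ w x ys zs → degree w x (ys ++ zs) ≡ degree w x ys + degree w x zs
  degree-++ w x ys zs = trans
    (cong (length ∘ filter T?) (map-++ (triple w x) ys zs))
    (trans (cong length (filter-++ T? (map (triple w x) ys) (map (triple w x) zs))) (length-++ (edges w x ys)))

  degree₁-cong : ∀ {w x y w′ x′ y′} → triple w x y ≡ triple w′ x′ y′ →
    degree w x (y ∷ []) ≡ degree w′ x′ (y′ ∷ [])
  degree₁-cong eq = cong (λ F → length (filter T? (F ∷ []))) eq

  -- All third vertices lie in `zs`, where the places taken by `ks` are lost to them because `ks`
  -- has no member in `ys`.
  degree≤ : ∀ {w x} ks {ys} zs → Unique ks → Unique ys → (∀ {y} → y ∈ˡ ks → ¬ (y ∈ˡ ys)) → ks ⊆ˡ zs →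
    (∀ {y} → y ∈ˡ ys → T (triple w x y) → y ∈ˡ zs) → length ks + degree w x ys ≤ length zs
  degree≤ {w} {x} ks {ys} zs !ks !ys ks#ys ks⊆ ys⊆ = subst (_≤ length zs) eq
    (unique-length-≤ (Unique.++⁺ !ks (Unique.filter⁺ P? !ys) λ (y∈ks , y∈) → ks#ys y∈ks (proj₁ (∈-filter⁻ P? y∈)))
      λ y∈ → [ ks⊆ , (λ y∈ → let (y∈ys , py) = ∈-filter⁻ P? {xs = ys} y∈ in ys⊆ y∈ys py) ]′ (∈-++⁻ ks y∈))
    where
    P? = T? ∘ triple w x
    eq : length (ks ++ filter P? ys) ≡ length ks + degree w x ys
    eq = trans (length-++ ks) (cong (length ks +_) (sym (length-filter-map T? (triple w x) ys)))

  degree-zero-or-edge : ∀ w x ys → degree w x ys ≡ 0 ⊎ ∃ λ y → y ∈ˡ ys × T (triple w x y)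
  degree-zero-or-edge w x []       = inj₁ refl
  degree-zero-or-edge w x (y ∷ ys) with T? (triple w x y)
  ... | yes t = inj₂ (y , here refl , t)
  ... | no _  with degree-zero-or-edge w x ys
  ...   | inj₁ eq            = inj₁ eq
  ...   | inj₂ (z , z∈ , t) = inj₂ (z , there z∈ , t)

  third-in-matching : ∀ {A B w x y} → T A → T B → Disjoint A B → w ∉ A → w ∉ B → x ∉ A → x ∉ B →
    T (triple w x y) → y ∈ A ⊎ y ∈ B
  third-in-matching A∈ B∈ A#B w∉A w∉B x∉A x∉B t with meets-matching A∈ B∈ A#B t
  ... | z , z∈ , z∈AB with ∈-triple⁻ z∈
  ...   | inj₁ refl        = ⊥-elim ([ w∉A , w∉B ]′ z∈AB)
  ...   | inj₂ (inj₁ refl) = ⊥-elim ([ x∉A , x∉B ]′ z∈AB)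
  ...   | inj₂ (inj₂ refl) = z∈AB

  private
    ∣elements∣ : ∀ {E} → T E → length (elements E) ≡ 3
    ∣elements∣ {E} E∈ = trans (length-elements E) (size E∈)

    ∣elements₂∣ : ∀ {E F} → T E → T F → length (elements E ++ elements F) ≡ 6
    ∣elements₂∣ {E} E∈ F∈ = trans (length-++ (elements E)) (cong₂ _+_ (∣elements∣ E∈) (∣elements∣ F∈))

  degree≤6 : ∀ w x {ys} → Unique ys → degree w x ys ≤ 6
  degree≤6 w x {ys} !ys = subst (degree w x ys ≤_) (∣elements₂∣ A∈ B∈)
    (degree≤ [] _ [] !ys (λ ()) (λ ()) λ _ t →
      [ ∈-++⁺ˡ ∘ ∈-elements⁺ , ∈-++⁺ʳ (elements A) ∘ ∈-elements⁺ ]′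
        (third-in-matching A∈ B∈ A#B w∉A w∉B x∉A x∉B t))
    where open MatchingAvoiding (matching-avoiding w x)

  -- The edges `E` and `F` form a 2-matching avoiding `w` and `x`, so every third vertex is in one
  -- of them; those in `ys` are not in `E`, which leaves the three points of `F`.
  degree≤3-disjoint : ∀ {E F w x ys} → T E → T F → Disjoint E F → w ∉ E → x ∉ E → w ∉ F → x ∉ F →
    (∀ {y} → y ∈ˡ ys → y ∉ E) → Unique ys → degree w x ys ≤ 3
  degree≤3-disjoint {ys = ys} E∈ F∈ E#F w∉E x∉E w∉F x∉F ys∉E !ys = subst (degree _ _ ys ≤_) (∣elements∣ F∈)
    (degree≤ [] _ [] !ys (λ ()) (λ ()) λ y∈ t →
      [ (λ y∈E → contradiction y∈E (ys∉E y∈)) , ∈-elements⁺ ]′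
        (third-in-matching E∈ F∈ E#F w∉E w∉F x∉E x∉F t))

  -- If `E` misses one edge of the chosen matching, it forms a 2-matching with that edge. Otherwise
  -- it has a point in each of the two edges.
  degree-outside : ∀ {E w x ys} → T E → w ∉ E → x ∉ E → (∀ {y} → y ∈ˡ ys → y ∉ E) → Unique ys →
    degree w x ys ≤ 3 ⊎
    ∃₂ λ p q → p ∈ E × q ∈ E ×
      p ∈ MatchingAvoiding.A (matching-avoiding w x) × q ∈ MatchingAvoiding.B (matching-avoiding w x)
  degree-outside {E} {w} {x} E∈ w∉E x∉E ys∉E !ys = go
    where
    open MatchingAvoiding (matching-avoiding w x)
    go : _
    go with disjoint-or-common E A | disjoint-or-common E B
    ... | inj₁ E#A | _ = inj₁ (degree≤3-disjoint E∈ A∈ E#A w∉E x∉E w∉A x∉A ys∉E !ys)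
    ... | inj₂ _ | inj₁ E#B = inj₁ (degree≤3-disjoint E∈ B∈ E#B w∉E x∉E w∉B x∉B ys∉E !ys)
    ... | inj₂ (p , p∈E , p∈A) | inj₂ (q , q∈E , q∈B) = inj₂ (p , q , p∈E , q∈E , p∈A , q∈B)

  degree≤4 : ∀ {E w x ys} → T E → w ∉ E → x ∉ E → (∀ {y} → y ∈ˡ ys → y ∉ E) → Unique ys → degree w x ys ≤ 4
  degree≤4 {E} {w} {x} {ys} E∈ w∉E x∉E ys∉E !ys with degree-outside E∈ w∉E x∉E ys∉E !ys
  ... | inj₁ ≤3 = m≤n⇒m≤1+n ≤3
  -- Of the six points of the matching, `p` and `q` lie in `E` and so are no third vertices.
  ... | inj₂ (p , q , p∈E , q∈E , p∈A , q∈B) = +-cancelˡ-≤ 2 _ _ (subst (2 + degree w x ys ≤_) (∣elements₂∣ A∈ B∈)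
    (degree≤ (p ∷ q ∷ []) _ ((p≢q ∷ []) ∷ [] ∷ []) !ys
      (λ { (here refl) y∈ → ys∉E y∈ p∈E ; (there (here refl)) y∈ → ys∉E y∈ q∈E })
      (λ { (here refl) → ∈-++⁺ˡ (∈-elements⁺ p∈A) ; (there (here refl)) → ∈-++⁺ʳ (elements A) (∈-elements⁺ q∈B) })
      λ _ t → [ ∈-++⁺ˡ ∘ ∈-elements⁺ , ∈-++⁺ʳ (elements A) ∘ ∈-elements⁺ ]′
        (third-in-matching A∈ B∈ A#B w∉A w∉B x∉A x∉B t)))
    where
    open MatchingAvoiding (matching-avoiding w x)
    p≢q : p ≢ q
    p≢q refl = disjoint⁻ A#B p∈A q∈B

  degree≤3 : ∀ {E E′ w x ys} → T E → T E′ → Disjoint E E′ → w ∉ E → x ∉ E →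
    (∀ {y} → y ∈ˡ ys → y ∉ E) → (∀ {y} → y ∈ˡ ys → y ∉ E′) → Unique ys → degree w x ys ≤ 3
  degree≤3 {E} {E′} {w} {x} {ys} E∈ E′∈ E#E′ w∉E x∉E ys∉E ys∉E′ !ys with degree-outside E∈ w∉E x∉E ys∉E !ys
  ... | inj₁ ≤3 = ≤3
  ... | inj₂ (p , q , p∈E , q∈E , p∈A , q∈B)
    -- Being an edge, `E′` also has a point `r` in the matching. It differs from `p` and `q` since
    -- `E` and `E′` are disjoint, so three of the six points are lost.
    with meets-matching A∈ B∈ A#B E′∈
    where open MatchingAvoiding (matching-avoiding w x)
  ... | r , r∈E′ , r∈AB = +-cancelˡ-≤ 3 _ _ (subst (3 + degree w x ys ≤_) (∣elements₂∣ A∈ B∈)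
    (degree≤ (p ∷ q ∷ r ∷ []) _ ((p≢q ∷ E≢E′ p∈E ∷ []) ∷ (E≢E′ q∈E ∷ []) ∷ [] ∷ []) !ys
      (λ { (here refl) y∈ → ys∉E y∈ p∈E ; (there (here refl)) y∈ → ys∉E y∈ q∈E
         ; (there (there (here refl))) y∈ → ys∉E′ y∈ r∈E′ })
      (λ { (here refl) → ∈-++⁺ˡ (∈-elements⁺ p∈A) ; (there (here refl)) → ∈-++⁺ʳ (elements A) (∈-elements⁺ q∈B)
         ; (there (there (here refl))) → in-AB r∈AB })
      λ _ t → in-AB (third-in-matching A∈ B∈ A#B w∉A w∉B x∉A x∉B t)))
    where
    open MatchingAvoiding (matching-avoiding w x)
    p≢q : p ≢ q
    p≢q refl = disjoint⁻ A#B p∈A q∈B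
    E≢E′ : ∀ {s} → s ∈ E → s ≢ r
    E≢E′ s∈E refl = disjoint⁻ E#E′ s∈E r∈E′
    in-AB : ∀ {y} → y ∈ A ⊎ y ∈ B → y ∈ˡ elements A ++ elements B
    in-AB = [ ∈-++⁺ˡ ∘ ∈-elements⁺ , ∈-++⁺ʳ (elements A) ∘ ∈-elements⁺ ]′

  -- The constraints at the corners of A

  record Frame (u v : Fin n) (A B : Subset n) (O : List (Fin n)) : Set where
    field
      A∈     : T A
      B∈     : T B
      A#B    : Disjoint A B
      u≢v    : u ≢ v
      u∉A    : u ∉ A
      u∉B    : u ∉ B
      v∉A    : v ∉ A
      v∉B    : v ∉ B
      !O     : Unique O
      O∉A    : ∀ {y} → y ∈ˡ O → y ∉ A
      O∉B    : ∀ {y} → y ∈ˡ O → y ∉ B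
      O≢u    : ∀ {y} → y ∈ˡ O → y ≢ u
      O≢v    : ∀ {y} → y ∈ˡ O → y ≢ v
      O-full : ∀ {y} → y ∉ A → y ∉ B → y ≢ u → y ≢ v → y ∈ˡ O

  -- The constraints are proved for the end u and the side A only; the two exchanges carry them over
  -- to v and to B.
  swap-ends : ∀ {u v A B O} → Frame u v A B O → Frame v u A B O
  swap-ends f = record
    { A∈ = A∈ ; B∈ = B∈ ; A#B = A#B ; u≢v = u≢v ∘ sym
    ; u∉A = v∉A ; u∉B = v∉B ; v∉A = u∉A ; v∉B = u∉B
    ; !O = !O ; O∉A = O∉A ; O∉B = O∉B ; O≢u = O≢v ; O≢v = O≢u
    ; O-full = λ y∉A y∉B y≢v y≢u → O-full y∉A y∉B y≢u y≢v }
    where open Frame f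

  swap-sides : ∀ {u v A B O} → Frame u v A B O → Frame u v B A O
  swap-sides {A = A} f = record
    { A∈ = B∈ ; B∈ = A∈ ; A#B = disjoint-sym {F = A} A#B ; u≢v = u≢v
    ; u∉A = u∉B ; u∉B = u∉A ; v∉A = v∉B ; v∉B = v∉A
    ; !O = !O ; O∉A = O∉B ; O∉B = O∉A ; O≢u = O≢u ; O≢v = O≢v
    ; O-full = λ y∉B y∉A → O-full y∉A y∉B }
    where open Frame f

  degree≤length : ∀ w x ys → degree w x ys ≤ length ys
  degree≤length w x ys = subst (degree w x ys ≤_) (length-map (triple w x) ys)
    (length-filter T? (map (triple w x) ys))

  ends-swap : ∀ u x v → degree v x (u ∷ []) ≡ degree u x (v ∷ [])
  ends-swap u x v = degree₁-cong (triple-reverse v x u)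

  module _ {u v A B O} (f : Frame u v A B O) where
    open Frame f

    private
      A∌B : ∀ {x} → x ∈ A → x ∉ B
      A∌B = disjoint⁻ A#B

      ≢∈ : ∀ {w x} → w ∉ A → x ∈ A → w ≢ x
      ≢∈ w∉A x∈A refl = w∉A x∈A

    -- Both edges miss B, so if disjoint they would form three disjoint edges with it. The
    -- inequalities keep the common point away from u and v.
    edges-intersect : ∀ {x y x′ y′} → x ∉ B → y ∉ B → x′ ∉ B → y′ ∉ B →
      u ≢ x′ → u ≢ y′ → x ≢ v → y ≢ v →
      T (triple u x y) → T (triple v x′ y′) → x ≡ x′ ⊎ x ≡ y′ ⊎ y ≡ x′ ⊎ y ≡ y′
    edges-intersect {x} {y} {x′} {y′} x∉ y∉ x′∉ y′∉ u≢x′ u≢y′ x≢v y≢v t t′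
      with disjoint-or-common (triple u x y) (triple v x′ y′)
    ... | inj₁ t#t′ = ⊥-elim (no-three-disjoint B∈ t t′
      (disjoint⁺ (avoid u∉B x∉ y∉)) (disjoint⁺ (avoid v∉B x′∉ y′∉)) t#t′)
      where
      avoid : ∀ {w x y s} → w ∉ B → x ∉ B → y ∉ B → s ∈ B → s ∉ triple w x y
      avoid w∉ x∉ y∉ s∈B s∈ with ∈-triple⁻ s∈
      ... | inj₁ refl        = w∉ s∈B
      ... | inj₂ (inj₁ refl) = x∉ s∈B
      ... | inj₂ (inj₂ refl) = y∉ s∈B
    ... | inj₂ (s , s∈ , s∈′) with ∈-triple⁻ s∈ | ∈-triple⁻ s∈′
    ...   | inj₁ p        | inj₁ q        = contradiction (trans (sym p) q) u≢v
    ...   | inj₁ p        | inj₂ (inj₁ q) = contradiction (trans (sym p) q) u≢x′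
    ...   | inj₁ p        | inj₂ (inj₂ q) = contradiction (trans (sym p) q) u≢y′
    ...   | inj₂ (inj₁ p) | inj₁ q        = contradiction (trans (sym p) q) x≢v
    ...   | inj₂ (inj₂ p) | inj₁ q        = contradiction (trans (sym p) q) y≢v
    ...   | inj₂ (inj₁ p) | inj₂ (inj₁ q) = inj₁ (trans (sym p) q)
    ...   | inj₂ (inj₁ p) | inj₂ (inj₂ q) = inj₂ (inj₁ (trans (sym p) q))
    ...   | inj₂ (inj₂ p) | inj₂ (inj₁ q) = inj₂ (inj₂ (inj₁ (trans (sym p) q)))
    ...   | inj₂ (inj₂ p) | inj₂ (inj₂ q) = inj₂ (inj₂ (inj₂ (trans (sym p) q)))

    half-local : ∀ {x y z} → x ∈ A → y ∈ A → z ∈ A → x ≢ y → x ≢ z →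
      HalfLocal (degree u x O) (degree u y (z ∷ [])) (degree v y (z ∷ []))
        (degree u x (v ∷ [])) (degree u x (elements B))
    half-local {x} {y} {z} x∈ y∈ z∈ x≢y x≢z = half
      (subst (_≤ 3) (degree-∷ u x v O)
        -- B takes the part of `E` and A that of `E′`: v and the points of `O` lie in neither.
        (degree≤3 B∈ A∈ (disjoint-sym {F = A} A#B) u∉B (A∌B x∈)
          (λ { (here refl) → v∉B ; (there o∈) → O∉B o∈ }) (λ { (here refl) → v∉A ; (there o∈) → O∉A o∈ })
          (All.tabulate (λ o∈ v≡o → O≢v o∈ (sym v≡o)) ∷ !O)))
      (degree≤length u y (z ∷ []))
      (≤-trans (degree≤length u x (elements B)) (≤-reflexive (∣elements∣ B∈)))
      clash
      where
      clash : degree u x O ≡ 0 ⊎ degree v y (z ∷ []) ≡ 0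
      clash with degree-zero-or-edge u x O | degree-zero-or-edge v y (z ∷ [])
      ... | inj₁ eq | _ = inj₁ eq
      ... | inj₂ _  | inj₁ eq = inj₂ eq
      ... | inj₂ (o , o∈ , t) | inj₂ (_ , here refl , t′) with edges-intersect (A∌B x∈) (O∉B o∈) (A∌B y∈) (A∌B z∈)
        (≢∈ u∉A y∈) (≢∈ u∉A z∈) (≢∈ v∉A x∈ ∘ sym) (O≢v o∈) t t′
      ...   | inj₁ x≡y                = contradiction x≡y x≢y
      ...   | inj₂ (inj₁ x≡z)         = contradiction x≡z x≢z
      ...   | inj₂ (inj₂ (inj₁ refl)) = contradiction y∈ (O∉A o∈)
      ...   | inj₂ (inj₂ (inj₂ refl)) = contradiction z∈ (O∉A o∈)

    thin : ∀ {x x′} → x ∈ A → x′ ∈ A → x ≢ x′ → Thin (degree u x O) (degree v x′ O)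
    thin {x} {x′} x∈ x′∈ x≢x′ with degree-zero-or-edge u x O | degree-zero-or-edge v x′ O
    ... | inj₁ eq | _       = inj₁ eq
    ... | inj₂ _  | inj₁ eq = inj₂ (inj₁ eq)
    -- One fixed edge at each corner determines the third vertices at the other corner.
    ... | inj₂ (o , o∈ , t) | inj₂ (o′ , o′∈ , t′) = inj₂ (inj₂
      ( degree≤ [] (o′ ∷ []) [] !O (λ ()) (λ ()) (λ y∈ s → here (same y∈ o′∈ s t′))
      , degree≤ [] (o ∷ []) [] !O (λ ()) (λ ()) (λ y∈ s → here (sym (same o∈ y∈ t s)))))
      where
      same : ∀ {y y′} → y ∈ˡ O → y′ ∈ˡ O → T (triple u x y) → T (triple v x′ y′) → y ≡ y′
      same y∈ y′∈ t t′ with edges-intersect (A∌B x∈) (O∉B y∈) (A∌B x′∈) (O∉B y′∈)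
        (≢∈ u∉A x′∈) (O≢u y′∈ ∘ sym) (≢∈ v∉A x∈ ∘ sym) (O≢v y∈) t t′
      ... | inj₁ x≡x′                        = contradiction x≡x′ x≢x′
      ... | inj₂ (inj₁ refl)                 = contradiction x∈ (O∉A y′∈)
      ... | inj₂ (inj₂ (inj₁ refl))          = contradiction x′∈ (O∉A y∈)
      ... | inj₂ (inj₂ (inj₂ y≡y′))        = y≡y′

    -- The points v, y, z and those of `O` are all the candidates outside B. The edge {u,x,z}
    -- appears as `degree u z (x ∷ [])` because that is how the profile at y records its opposite
    -- pair.
    star : ∀ {x y z} → x ∈ A → y ∈ A → z ∈ A → y ≢ z →
      let d = degree u x (v ∷ []) + (degree u x (y ∷ []) + (degree u z (x ∷ []) + degree u x O)) in
      d ≤ 4 × degree u x (elements B) + d ≤ 6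
    star {x} {y} {z} x∈ y∈ z∈ y≢z =
      subst (_≤ 4) eq (degree≤4 B∈ u∉B (A∌B x∈) rest∉B !rest) ,
      subst (_≤ 6) (trans (degree-++ u x (elements B) rest) (cong (degree u x (elements B) +_) eq))
        (degree≤6 u x (Unique.++⁺ (elements-unique B) !rest λ (b∈ , y∈) → rest∉B y∈ (∈-elements⁻ B b∈)))
      where
      rest = v ∷ y ∷ z ∷ O

      !rest : Unique rest
      !rest = ((λ { refl → v∉A y∈ }) ∷ (λ { refl → v∉A z∈ }) ∷ All.tabulate (λ o∈ v≡o → O≢v o∈ (sym v≡o)))
        ∷ (y≢z ∷ All.tabulate (λ { o∈ refl → O∉A o∈ y∈ }))
        ∷ All.tabulate (λ { o∈ refl → O∉A o∈ z∈ })
        ∷ !O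

      rest∉B : ∀ {s} → s ∈ˡ rest → s ∉ B
      rest∉B (here refl)                 = v∉B
      rest∉B (there (here refl))         = A∌B y∈
      rest∉B (there (there (here refl))) = A∌B z∈
      rest∉B (there (there (there o∈)))  = O∉B o∈

      eq : degree u x rest ≡ degree u x (v ∷ []) + (degree u x (y ∷ []) + (degree u z (x ∷ []) + degree u x O))
      eq = trans (degree-∷ u x v _) (cong (degree u x (v ∷ []) +_)
        (trans (degree-∷ u x y _) (cong (degree u x (y ∷ []) +_)
        (trans (degree-∷ u x z _) (cong (_+ degree u x O) (degree₁-cong (triple-swapʳ u x z)))))))

  -- Charging the edges to the corners

  module _ (u v : Fin n) (O : List (Fin n)) where

    -- The edges charged to the corner x; the pair {y,z} is charged to the opposite corner.
    block : Fin n → Fin n → Fin n → List (Subset n)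
    block x y z = edges u x O ++ edges v x O ++ edges u y (z ∷ []) ++ edges v y (z ∷ []) ++ edges u x (v ∷ [])

    row : Subset n → Fin n → List (Subset n)
    row B x = edges u x (elements B) ++ edges v x (elements B)

    -- For a `Frame`, these are the edges counted by H, and those of `cross` the ones counted by C.
    own : ∀ {A} → Corners A → List (Subset n)
    own k = block a b c ++ block b c a ++ block c a b
      where open Corners k

    cross : ∀ {A} → Corners A → Subset n → List (Subset n)
    cross k B = row B a ++ row B b ++ row B c
      where open Corners k

    profile-at : Subset n → Fin n → Fin n → Fin n → Profile
    profile-at B x y z = profile (degree u x O) (degree v x O) (degree u y (z ∷ [])) (degree v y (z ∷ []))
      (degree u x (v ∷ [])) (degree u x (elements B)) (degree v x (elements B))

    weight-profile-at : ∀ B x y z → weight (profile-at B x y z) ≡ 2 * length (block x y z) + length (row B x)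
    weight-profile-at B x y z = trans (regroup (degree u x O) _ _ _ _ _ _)
      (cong₂ (λ s t → 2 * s + t) (sym eq) (sym (length-++ (edges u x (elements B)))))
      where
      regroup : ∀ α β i j s c d → 2 * (α + β + i + j + s) + c + d ≡ 2 * (α + (β + (i + (j + s)))) + (c + d)
      regroup = solve-∀
      eq : length (block x y z) ≡ _
      eq = trans (length-++ (edges u x O)) (cong (degree u x O +_)
        (trans (length-++ (edges v x O)) (cong (degree v x O +_)
        (trans (length-++ (edges u y (z ∷ []))) (cong (degree u y (z ∷ []) +_)
        (length-++ (edges v y (z ∷ []))))))))

    profiles-admissible : ∀ {A B} → Frame u v A B O → (k : Corners A) → let open Corners k in
      Admissible (profile-at B a b c) (profile-at B b c a) (profile-at B c a b)
    profiles-admissible {A} {B} f k = admissible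
      (local a∈ b∈ c∈ a≢b (c≢a ∘ sym)) (local b∈ c∈ a∈ b≢c (a≢b ∘ sym)) (local c∈ a∈ b∈ c≢a (b≢c ∘ sym))
      (thin f a∈ b∈ a≢b) (thin f b∈ a∈ (a≢b ∘ sym)) (thin f a∈ c∈ (c≢a ∘ sym))
      (thin f c∈ a∈ c≢a) (thin f b∈ c∈ b≢c) (thin f c∈ b∈ (b≢c ∘ sym))
      (stars a∈ b∈ c∈ b≢c) (stars b∈ c∈ a∈ c≢a) (stars c∈ a∈ b∈ a≢b)
      where
      open Corners k
      local : ∀ {x y z} → x ∈ A → y ∈ A → z ∈ A → x ≢ y → x ≢ z → Local (profile-at B x y z)
      local {x} {y} {z} x∈ y∈ z∈ x≢y x≢z = degree≤length u x (v ∷ []) , half-local f x∈ y∈ z∈ x≢y x≢z ,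
        -- Exchanging u and v turns {u,x,v} into {v,x,u}, which `ends-swap` identifies with the
        -- first.
        subst (λ s → HalfLocal (degree v x O) (degree v y (z ∷ [])) (degree u y (z ∷ [])) s (degree v x (elements B)))
          (ends-swap u x v) (half-local (swap-ends f) x∈ y∈ z∈ x≢y x≢z)
      stars : ∀ {x y z} → x ∈ A → y ∈ A → z ∈ A → y ≢ z →
        Stars (profile-at B x y z) (profile-at B y z x) (profile-at B z x y)
      stars {x} {y} {z} x∈ y∈ z∈ y≢z = star f x∈ y∈ z∈ y≢z ,
        subst (λ s → let d = s + (degree v x (y ∷ []) + (degree v z (x ∷ []) + degree v x O)) in
            d ≤ 4 × degree v x (elements B) + d ≤ 6)
          (ends-swap u x v) (star (swap-ends f) x∈ y∈ z∈ y≢z)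

    own-cross-≤36 : ∀ {A B} → Frame u v A B O → (k : Corners A) → 2 * length (own k) + length (cross k B) ≤ 36
    own-cross-≤36 {A} {B} f k = subst (_≤ 36) eq (weight≤36 (profiles-admissible f k))
      where
      open Corners k
      regroup : ∀ p q r s t w → (2 * p + s) + ((2 * q + t) + (2 * r + w)) ≡ 2 * (p + (q + r)) + (s + (t + w))
      regroup = solve-∀
      eq : weight (profile-at B a b c) + (weight (profile-at B b c a) + weight (profile-at B c a b))
        ≡ 2 * length (own k) + length (cross k B)
      eq = trans (cong₂ _+_ (weight-profile-at B a b c) (cong₂ _+_ (weight-profile-at B b c a) (weight-profile-at B c a b)))
        (trans (regroup (length (block a b c)) (length (block b c a)) (length (block c a b)) _ _ _)
        (cong₂ (λ s t → 2 * s + t)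
          (sym (trans (length-++ (block a b c)) (cong (length (block a b c) +_) (length-++ (block b c a)))))
          (sym (trans (length-++ (row B a)) (cong (length (row B a) +_) (length-++ (row B b)))))))

    -- Only the rotations of (a,b,c) occur as blocks of `own`, so an opposite pair is listed in just
    -- one of its two orders.
    data Cyclic {A} (k : Corners A) : Fin n → Fin n → Fin n → Set where
      abc : let open Corners k in Cyclic k a b c
      bca : let open Corners k in Cyclic k b c a
      cab : let open Corners k in Cyclic k c a b

    block⊆own : ∀ {A} {k : Corners A} {x y z} → Cyclic k x y z → block x y z ⊆ˡ own k
    block⊆own         abc F∈ = ∈-++⁺ˡ F∈
    block⊆own {k = k} bca F∈ = ∈-++⁺ʳ (block a b c) (∈-++⁺ˡ F∈)
      where open Corners k
    block⊆own {k = k} cab F∈ = ∈-++⁺ʳ (block a b c) (∈-++⁺ʳ (block b c a) F∈)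
      where open Corners k

    row⊆cross : ∀ {A} B {k : Corners A} {x y z} → Cyclic k x y z → row B x ⊆ˡ cross k B
    row⊆cross _         abc F∈ = ∈-++⁺ˡ F∈
    row⊆cross B {k = k} bca F∈ = ∈-++⁺ʳ (row B a) (∈-++⁺ˡ F∈)
      where open Corners k
    row⊆cross B {k = k} cab F∈ = ∈-++⁺ʳ (row B a) (∈-++⁺ʳ (row B b) F∈)
      where open Corners k

    cyclic-from : ∀ {A} (k : Corners A) {x} → x ∈ A → ∃₂ λ y z → Cyclic k x y z
    cyclic-from k x∈ with Corners.cover k x∈
    ... | here refl                 = _ , _ , abc
    ... | there (here refl)         = _ , _ , bca
    ... | there (there (here refl)) = _ , _ , cab

    cyclic-pair : ∀ {A} (k : Corners A) {x y} → x ∈ A → y ∈ A → y ≢ x → ∃ λ z → Cyclic k z x y ⊎ Cyclic k z y x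
    cyclic-pair k x∈ y∈ y≢x with Corners.cover k x∈ | Corners.cover k y∈
    ... | here refl                 | here refl                 = contradiction refl y≢x
    ... | here refl                 | there (here refl)         = _ , inj₁ cab
    ... | here refl                 | there (there (here refl)) = _ , inj₂ bca
    ... | there (here refl)         | here refl                 = _ , inj₂ cab
    ... | there (here refl)         | there (here refl)         = contradiction refl y≢x
    ... | there (here refl)         | there (there (here refl)) = _ , inj₁ abc
    ... | there (there (here refl)) | here refl                 = _ , inj₁ bca
    ... | there (there (here refl)) | there (here refl)         = _ , inj₂ abc
    ... | there (there (here refl)) | there (there (here refl)) = contradiction refl y≢x

    module _ {F : Subset n} (F∈ : T F) where

      ∈-row : ∀ {B w x y} → w ≡ u ⊎ w ≡ v → y ∈ B → F ≡ triple w x y → F ∈ˡ row B x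
      ∈-row             (inj₁ refl) y∈ eq = ∈-++⁺ˡ (∈-edges⁺ F∈ eq (∈-elements⁺ y∈))
      ∈-row {B} {x = x} (inj₂ refl) y∈ eq = ∈-++⁺ʳ (edges u x (elements B)) (∈-edges⁺ F∈ eq (∈-elements⁺ y∈))

      ∈-block-out : ∀ {w x y z o} → w ≡ u ⊎ w ≡ v → o ∈ˡ O → F ≡ triple w x o → F ∈ˡ block x y z
      ∈-block-out         (inj₁ refl) o∈ eq = ∈-++⁺ˡ (∈-edges⁺ F∈ eq o∈)
      ∈-block-out {x = x} (inj₂ refl) o∈ eq = ∈-++⁺ʳ (edges u x O) (∈-++⁺ˡ (∈-edges⁺ F∈ eq o∈))

      ∈-block-opp : ∀ {w x y z} → w ≡ u ⊎ w ≡ v → F ≡ triple w y z → F ∈ˡ block x y z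
      ∈-block-opp {x = x}             (inj₁ refl) eq =
        ∈-++⁺ʳ (edges u x O) (∈-++⁺ʳ (edges v x O) (∈-++⁺ˡ (∈-edges⁺ F∈ eq (here refl))))
      ∈-block-opp {x = x} {y} {z} (inj₂ refl) eq =
        ∈-++⁺ʳ (edges u x O) (∈-++⁺ʳ (edges v x O) (∈-++⁺ʳ (edges u y (z ∷ [])) (∈-++⁺ˡ (∈-edges⁺ F∈ eq (here refl)))))

      ∈-block-mid : ∀ {x y z} → F ≡ triple u x v → F ∈ˡ block x y z
      ∈-block-mid {x} {y} {z} eq = ∈-++⁺ʳ (edges u x O) (∈-++⁺ʳ (edges v x O)
        (∈-++⁺ʳ (edges u y (z ∷ [])) (∈-++⁺ʳ (edges v y (z ∷ [])) (∈-edges⁺ F∈ eq (here refl)))))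

      module _ {A B} (f : Frame u v A B O) (k : Corners A) (l : Corners B)
        {w x} (w≡ : w ≡ u ⊎ w ≡ v) (x∈A : x ∈ A) where

        private
          in-block-of-x : (∀ {y z} → F ∈ˡ block x y z) → F ∈ˡ own k
          in-block-of-x F∈x = block⊆own (proj₂ (proj₂ (cyclic-from k x∈A))) F∈x

        -- The position of the third vertex decides: in A it gives an opposite pair, in B a crossing
        -- edge, at the other end a middle edge, and elsewhere an edge into `O`.
        locate-third : ∀ {y} → y ≢ w → y ≢ x → F ≡ triple w x y →
          Dec (y ∈ A) → Dec (y ∈ B) → Dec (y ≡ u) → Dec (y ≡ v) →
          F ∈ˡ own k ⊎ (F ∈ˡ cross k B × F ∈ˡ cross l A)
        locate-third y≢w y≢x eq (yes y∈A) _ _ _ = inj₁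
          ([ (λ zxy → block⊆own zxy (∈-block-opp w≡ eq))
           , (λ zyx → block⊆own zyx (∈-block-opp w≡ (trans eq (triple-swapʳ w x _)))) ]′
           (proj₂ (cyclic-pair k x∈A y∈A y≢x)))
        -- The same edge is charged to its corner in A and, with the sides exchanged, to its corner
        -- in B.
        locate-third y≢w y≢x eq (no _) (yes y∈B) _ _ =
          inj₂ ( row⊆cross B (proj₂ (proj₂ (cyclic-from k x∈A))) (∈-row w≡ y∈B eq)
               , row⊆cross A (proj₂ (proj₂ (cyclic-from l y∈B))) (∈-row w≡ x∈A (trans eq (triple-swapʳ w x _))))
        locate-third y≢w y≢x eq (no _) (no _) (yes refl) _ = inj₁ (in-block-of-x (∈-block-mid (other w≡)))
          where
          other : w ≡ u ⊎ w ≡ v → F ≡ triple u x v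
          other (inj₁ refl) = contradiction refl y≢w
          other (inj₂ refl) = trans eq (triple-reverse v x u)
        locate-third y≢w y≢x eq (no _) (no _) (no _) (yes refl) = inj₁ (in-block-of-x (∈-block-mid (other w≡)))
          where
          other : w ≡ u ⊎ w ≡ v → F ≡ triple u x v
          other (inj₁ refl) = eq
          other (inj₂ refl) = contradiction refl y≢w
        locate-third y≢w y≢x eq (no y∉A) (no y∉B) (no y≢u) (no y≢v) =
          inj₁ (in-block-of-x (∈-block-out w≡ (Frame.O-full f y∉A y∉B y≢u y≢v) eq))

        locate : w ∈ F → x ∈ F → F ∈ˡ own k ⊎ (F ∈ˡ cross k B × F ∈ˡ cross l A)
        locate w∈ x∈ =
          let (y , _ , y≢w , y≢x , eq) = third-vertex (size F∈) w∈ x∈ (w≢x w≡)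
          in locate-third y≢w y≢x eq (y ∈? A) (y ∈? B) (y Fin.≟ u) (y Fin.≟ v)
          where
          w≢x : w ≡ u ⊎ w ≡ v → w ≢ x
          w≢x (inj₁ refl) refl = Frame.u∉A f x∈A
          w≢x (inj₂ refl) refl = Frame.v∉A f x∈A

  -- Counting the edges that meet {u,v}

  meeting-pair-≤36 : ∀ {u v} → u ≢ v → card (𝓣 meeting (⁅ u ⁆ ∪ ⁅ v ⁆)) ≤ 36
  meeting-pair-≤36 {u} {v} u≢v = average-bound (length ownA) (length ownB) (length crossA) (length crossB)
    (bound crossA proj₁) (bound crossB proj₂)
    (own-cross-≤36 u v O frame k) (own-cross-≤36 u v O (swap-sides frame) l)
    where
    open MatchingAvoiding (matching-avoiding u v)
    outer? = λ y → ¬? (y ∈? A) ×-dec ¬? (y ∈? B) ×-dec ¬? (y Fin.≟ u) ×-dec ¬? (y Fin.≟ v)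
    O = filter outer? (allFin n)

    outer : ∀ {y} → y ∈ˡ O → y ∉ A × y ∉ B × y ≢ u × y ≢ v
    outer y∈ = proj₂ (∈-filter⁻ outer? {xs = allFin n} y∈)

    frame : Frame u v A B O
    frame = record
      { A∈ = A∈ ; B∈ = B∈ ; A#B = A#B ; u≢v = u≢v
      ; u∉A = w∉A ; u∉B = w∉B ; v∉A = x∉A ; v∉B = x∉B
      ; !O = Unique.filter⁺ outer? (Unique.allFin⁺ n)
      ; O∉A = proj₁ ∘ outer
      ; O∉B = proj₁ ∘ proj₂ ∘ outer
      ; O≢u = proj₁ ∘ proj₂ ∘ proj₂ ∘ outer
      ; O≢v = proj₂ ∘ proj₂ ∘ proj₂ ∘ outer
      ; O-full = λ y∉A y∉B y≢u y≢v → ∈-filter⁺ outer? (∈-allFin _) (y∉A , y∉B , y≢u , y≢v)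
      }

    k = corners-of A (size A∈)
    l = corners-of B (size B∈)
    ownA = own u v O k
    ownB = own u v O l
    crossA = cross u v O k B
    crossB = cross u v O l A
    touching = members (𝓣 meeting (⁅ u ⁆ ∪ ⁅ v ⁆))

    is-end : ∀ {w} → w ∈ ⁅ u ⁆ ∪ ⁅ v ⁆ → w ≡ u ⊎ w ≡ v
    is-end w∈uv = Sum.map (x∈⁅y⁆⇒x≡y u) (x∈⁅y⁆⇒x≡y v) (x∈p∪q⁻ ⁅ u ⁆ ⁅ v ⁆ w∈uv)

    classify : ∀ {F} → F ∈ˡ touching → F ∈ˡ ownA ⊎ F ∈ˡ ownB ⊎ (F ∈ˡ crossA × F ∈ˡ crossB)
    classify {F} F∈touching =
      let (F∈ , w , w∈)       = ∈-filter⁻ (λ F → nonempty? (F ∩ (⁅ u ⁆ ∪ ⁅ v ⁆))) {xs = members 𝓣} F∈touching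
          (w∈F , w∈uv)        = x∈p∩q⁻ F (⁅ u ⁆ ∪ ⁅ v ⁆) w∈
          (x , x∈F , x∈A⊎x∈B) = meets-matching A∈ B∈ A#B F∈
      in [ (λ x∈A → [ inj₁ , inj₂ ∘ inj₂ ]′ (locate u v O F∈ frame k l (is-end w∈uv) x∈A w∈F x∈F))
         -- For a point in B the sides are exchanged, and with them the two lists of crossing edges.
         , (λ x∈B → inj₂ (Sum.map id Product.swap
             (locate u v O F∈ (swap-sides frame) l k (is-end w∈uv) x∈B w∈F x∈F)))
         ]′ x∈A⊎x∈B

    bound : ∀ C → (∀ {F} → F ∈ˡ crossA × F ∈ˡ crossB → F ∈ˡ C) →
      length touching ≤ length ownA + (length ownB + length C)
    bound C into = subst (length touching ≤_) (trans (length-++ ownA) (cong (length ownA +_) (length-++ ownB)))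
      (unique-length-≤ (unique (𝓣 meeting (⁅ u ⁆ ∪ ⁅ v ⁆))) λ F∈ →
        [ ∈-++⁺ˡ , ∈-++⁺ʳ ownA ∘ [ ∈-++⁺ˡ , ∈-++⁺ʳ ownB ∘ into ]′ ]′ (classify F∈))

  -- Enlarging {u} to {u,a} can only add edges, and a corner `a` of an edge avoiding u is different
  -- from u.
  meeting-vertex-≤36 : ∀ u → card (𝓣 meeting (⁅ u ⁆ ∪ ⁅ u ⁆)) ≤ 36
  meeting-vertex-≤36 u = ≤-trans
    (unique-length-≤ (unique (𝓣 meeting (⁅ u ⁆ ∪ ⁅ u ⁆))) widen)
    (meeting-pair-≤36 u≢a)
    where
    open MatchingAvoiding (matching-avoiding u u)
    open Corners (corners-of A (size A∈))
    u≢a : u ≢ a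
    u≢a u≡a = w∉A (subst (_∈ A) (sym u≡a) a∈)
    widen : members (𝓣 meeting (⁅ u ⁆ ∪ ⁅ u ⁆)) ⊆ˡ members (𝓣 meeting (⁅ u ⁆ ∪ ⁅ a ⁆))
    widen {F} F∈′ =
      let (F∈ , w , w∈) = ∈-filter⁻ (λ F → nonempty? (F ∩ (⁅ u ⁆ ∪ ⁅ u ⁆))) {xs = members 𝓣} F∈′
          (w∈F , w∈uu)  = x∈p∩q⁻ F (⁅ u ⁆ ∪ ⁅ u ⁆) w∈
      in ∈-filter⁺ (λ F → nonempty? (F ∩ (⁅ u ⁆ ∪ ⁅ a ⁆))) F∈
           (w , x∈p∩q⁺ (w∈F , x∈p∪q⁺ (inj₁ ([ id , id ]′ (x∈p∪q⁻ ⁅ u ⁆ ⁅ u ⁆ w∈uu)))))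

lemma1p7 : (n : ℕ) (𝓣 : Family n) → Uniform 3 𝓣 → Resilient 2 𝓣 → ν 𝓣 ≡ 2 →
    (u v : Fin n) → card (𝓣 meeting (⁅ u ⁆ ∪ ⁅ v ⁆)) ≤ 36
lemma1p7 n 𝓣 uniform resilient ν≡2 u v with u Fin.≟ v
... | yes refl = meeting-vertex-≤36 𝓣 uniform resilient ν≡2 u
... | no u≢v   = meeting-pair-≤36 𝓣 uniform resilient ν≡2 u≢v
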